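{- For any $p\geq0$, there exists a polynomial $T_p(b,r_0,\ldots,r_{p+1})$, homogeneous of degree $2p$ in $r_0,\ldots,r_{p+1}$, such that for any integer $b\geq0$, $$\bar M^{(b)}_p(x_b,x_{b+1},\ldots)=\frac{(R^{(b)})^{1-b}}{(\partial_{x_b}R^{(b)})^{2p+1}}\,T_p\big(b,R^{(b)},\partial_{x_b}R^{(b)},\ldots,\partial_{x_b}^{p+1}R^{(b)}\big).$$
   Context: With $\mathrm{Cat}(\ell)=\frac1{\ell+1}\binom{2\ell}\ell$, let $$Z^{(b)}(r;x_{b+1},x_{b+2},\ldots)=r\mathbf 1_{\{b=0\}}-\sum_{\ell=0}^b(-1)^{b-\ell}\binom{b+\ell}{2\ell}\mathrm{Cat}(\ell)r^{b-\ell}-\sum_{j=b+1}^\infty\binom{2j-1}{j+b}x_jr^{b+j},$$ and let $R^{(b)}(x_b,x_{b+1},\ldots)$ be the unique formal power series with constant term $1$ satisfying $Z^{(b)}(R^{(b)};x_{b+1},\ldots)=x_b$. For $p\geq0$ let $Q_p(b,j)$ be the unique polynomial with $$\sum_{k=b}^{j-1}\binom{2k+1+p}{2p+1}\binom{2j-1}{j+k}=\binom{2j-1}{j+b}Q_p(b,j)\quad\text{for all integers }j>b\geq0$$ (it exists, has degree $p+1$ in $j$, and satisfies $Q_p(b,-b)=0$). The moments are $$\bar M_p^{(b)}(x_b,x_{b+1},\ldots)=Q_p(b,r\,\partial_r)\,r^{ -b}Z^{(b)}(r;x_{b+1},x_{b+2},\ldots)\Big|_{r=R^{(b)}(x_b,x_{b+1},\ldots)},$$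 where $Q_p(b,r\partial_r)$ is the differential operator obtained by replacing $j$ by $r\,\partial_r$, acting on $r^{ -b}Z^{(b)}$. -}

module Defs where

open import Algebra.Bundles.Raw using (RawSemiring)
open import Algebra.Properties.CommutativeMonoid.Sum using (sum)
import Algebra.Definitions.RawSemiring as RawSemiringDefs
open import Data.Fin.Base using (toℕ)
open import Data.Integer.Base as ℤ using (ℤ; +_; -[1+_])
open import Data.List.Base as List using (List; []; _∷_; _∷ʳ_; _++_; upTo)
open import Data.List.Relation.Unary.All using (All)
open import Data.Nat.Base as ℕ using (ℕ; zero; suc; _∸_; _<_)
open import Data.Nat.Combinatorics using (_C_)
import Data.Nat.ListAction as ListAction
open import Data.Nat.ListAction.Properties using (sum-++)
import Data.Nat.Properties as ℕ
open import Data.Product.Base using (_×_; _,_)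
open import Data.Rational.Base as ℚ
  using (ℚ; 0ℚ; 1ℚ; _/_; 1/_; ≢-nonZero; +-*-rawSemiring)
open import Data.Rational.Properties as ℚ using (+-0-commutativeMonoid)
open import Data.Vec.Base as Vec using (Vec; []; _∷_)
open import Function.Base using (_∘_; id)
open import Level using (0ℓ)
open import Relation.Binary.PropositionalEquality
  using (_≡_; refl; sym; trans; cong; cong₂)
open import Relation.Nullary.Decidable using (yes; no)

open RawSemiringDefs +-*-rawSemiring public using () renaming (_^_ to _^ℚ_)

fromℤ : ℤ → ℚ
fromℤ z = z / 1

fromℕ : ℕ → ℚ
fromℕ n = fromℤ (+ n)

∑ : ℕ → (ℕ → ℚ) → ℚ
∑ n f = sum +-0-commutativeMonoid {n} (f ∘ toℕ)

∑-cong : ∀ n {f g : ℕ → ℚ} → (∀ i → f i ≡ g i) → ∑ n f ≡ ∑ n g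
∑-cong zero    eq = refl
∑-cong (suc n) eq = cong₂ ℚ._+_ (eq 0) (∑-cong n (eq ∘ suc))

-- Polynomials with rational coefficients in n variables, as formal sums of
-- terms (coefficient , exponents).  Exponents may repeat.

Polynomial : ℕ → Set
Polynomial n = List (ℚ × Vec ℕ n)

-- Evaluation in a (not necessarily commutative) ℚ-algebra with structure map ι.
module _ (S : RawSemiring 0ℓ 0ℓ) (ι : ℚ → RawSemiring.Carrier S) where
  open RawSemiring S using (Carrier; _+_; _*_; 0#; 1#)
  open RawSemiringDefs S using (_^_)

  evalMonomial : ∀ {n} → Vec Carrier n → Vec ℕ n → Carrier
  evalMonomial []       []       = 1#
  evalMonomial (a ∷ as) (e ∷ es) = a ^ e * evalMonomial as es

  eval : ∀ {n} → Polynomial n → Vec Carrier n → Carrier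
  eval []             as = 0#
  eval ((q , es) ∷ P) as = ι q * evalMonomial as es + eval P as

-- Homogeneous of degree d in all the variables except the first, which is
-- regarded as a parameter.
HomogeneousInTail : ∀ {n} → ℕ → Polynomial (suc n) → Set
HomogeneousInTail d = All λ (_ , es) → Vec.sum (Vec.tail es) ≡ d

-- Formal power series in variables y₀, y₁, y₂, … with coefficients in A.
-- The list e₀ ∷ e₁ ∷ … ∷ eₙ stands for the monomial y₀^e₀ ⋯ yₙ^eₙ; appending
-- zeros does not change the monomial, whence the second field.

Mon : Set
Mon = List ℕ

record Series (A : Set) : Set where
  field
    coeff  : Mon → A
    padded : ∀ m → coeff (m ∷ʳ 0) ≡ coeff m

open Series public

degree : Mon → ℕ
degree = ListAction.sum

infix 4 _≈_
_≈_ : ∀ {A} → Series A → Series A → Set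
f ≈ g = ∀ m → coeff f m ≡ coeff g m

mapS : ∀ {A B} → (A → B) → Series A → Series B
mapS h f .coeff    = h ∘ coeff f
mapS h f .padded m = cong h (padded f m)

zipWithS : ∀ {A B C} → (A → B → C) → Series A → Series B → Series C
zipWithS h f g .coeff m  = h (coeff f m) (coeff g m)
zipWithS h f g .padded m = cong₂ h (padded f m) (padded g m)

module _ {A : Set} (0# : A) where

  constCoeff : A → Mon → A
  constCoeff a []          = a
  constCoeff a (zero  ∷ m) = constCoeff a m
  constCoeff a (suc _ ∷ m) = 0#

  constS : A → Series A
  constS a .coeff  = constCoeff a
  constS a .padded = go
    where
    go : ∀ m → constCoeff a (m ∷ʳ 0) ≡ constCoeff a m
    go []          = refl
    go (zero  ∷ m) = go m
    go (suc _ ∷ m) = refl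

  linearCoeff : (ℕ → A) → Mon → A
  linearCoeff c []                = 0#
  linearCoeff c (zero        ∷ m) = linearCoeff (c ∘ suc) m
  linearCoeff c (suc zero    ∷ m) = constCoeff (c 0) m
  linearCoeff c (suc (suc _) ∷ m) = 0#

  -- The infinite sum c₀ y₀ + c₁ y₁ + c₂ y₂ + ⋯
  linearS : (ℕ → A) → Series A
  linearS c .coeff  = linearCoeff c
  linearS c .padded = go c
    where
    go : ∀ c m → linearCoeff c (m ∷ʳ 0) ≡ linearCoeff c m
    go c []                = refl
    go c (zero        ∷ m) = go (c ∘ suc) m
    go c (suc zero    ∷ m) = padded (constS (c 0)) m
    go c (suc (suc _) ∷ m) = refl

-- convolve h m is the sum of h u v over all factorisations of m into a
-- product of monomials u and v.
convolve : (Mon → Mon → ℚ) → Mon → ℚ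
convolve h []      = h [] []
convolve h (e ∷ m) = ∑ (suc e) λ i → convolve (λ u v → h (i ∷ u) (e ∸ i ∷ v)) m

convolve-padded : ∀ h → (∀ u v → h (u ∷ʳ 0) (v ∷ʳ 0) ≡ h u v) →
                  ∀ m → convolve h (m ∷ʳ 0) ≡ convolve h m
convolve-padded h eq []      = trans (ℚ.+-identityʳ _) (eq [] [])
convolve-padded h eq (e ∷ m) = ∑-cong (suc e) λ i →
  convolve-padded (λ u v → h (i ∷ u) (e ∸ i ∷ v))
                  (λ u v → eq (i ∷ u) (e ∸ i ∷ v)) m

PS : Set
PS = Series ℚ

infixl 6 _+ₛ_ _-ₛ_
infixl 7 _*ₛ_ _·ₛ_ _/ₛ_

_+ₛ_ _-ₛ_ _*ₛ_ : PS → PS → PS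
_+ₛ_ = zipWithS ℚ._+_
_-ₛ_ = zipWithS ℚ._-_
(f *ₛ g) .coeff    = convolve λ u v → coeff f u ℚ.* coeff g v
(f *ₛ g) .padded   = convolve-padded _ λ u v → cong₂ ℚ._*_ (padded f u) (padded g v)

_·ₛ_ : ℚ → PS → PS
q ·ₛ f = mapS (q ℚ.*_) f

ratS : ℚ → PS
ratS = constS 0ℚ

0ₛ 1ₛ : PS
0ₛ = ratS 0ℚ
1ₛ = ratS 1ℚ

PS-rawSemiring : RawSemiring 0ℓ 0ℓ
PS-rawSemiring = record
  { Carrier = PS ; _≈_ = _≈_ ; _+_ = _+ₛ_ ; _*_ = _*ₛ_ ; 0# = 0ₛ ; 1# = 1ₛ }

open RawSemiringDefs PS-rawSemiring public using () renaming (_^_ to _^ₛ_)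

y₀ : PS
y₀ = linearS 0ℚ λ { zero → 1ℚ ; (suc _) → 0ℚ }

constantTerm : PS → ℚ
constantTerm f = coeff f []

∂ : PS → PS
∂ f .coeff []         = fromℕ 1 ℚ.* coeff f (1 ∷ [])
∂ f .coeff (e ∷ m)    = fromℕ (suc e) ℚ.* coeff f (suc e ∷ m)
∂ f .padded []        = refl
∂ f .padded (e ∷ m)   = cong (fromℕ (suc e) ℚ.*_) (padded f (suc e ∷ m))

∂^ : ℕ → PS → PS
∂^ zero    f = f
∂^ (suc i) f = ∂ (∂^ i f)

recip : ℚ → ℚ
recip q with q ℚ.≟ 0ℚ
... | yes _  = 0ℚ
... | no q≢0 = 1/_ q {{≢-nonZero q≢0}}

-- With c the constant term of f, the geometric series c⁻¹ ∑ₙ (1 - c⁻¹ f)ⁿ.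
-- Since 1 - c⁻¹ f has no constant term, only n ≤ degree m contributes to the
-- coefficient of m.  This is the multiplicative inverse whenever c is nonzero
-- (and 0 otherwise).
inv : PS → PS
inv f .coeff m = c⁻¹ ℚ.* ∑ (suc (degree m)) λ n → coeff ((1ₛ -ₛ c⁻¹ ·ₛ f) ^ₛ n) m
  where c⁻¹ = recip (constantTerm f)
inv f .padded m
  rewrite sum-++ m (0 ∷ []) | ℕ.+-identityʳ (degree m)
  = cong (recip (constantTerm f) ℚ.*_) (∑-cong (suc (degree m)) λ n →
      padded ((1ₛ -ₛ recip (constantTerm f) ·ₛ f) ^ₛ n) m)

_/ₛ_ : PS → PS → PS
f /ₛ g = f *ₛ inv g

_^ᶻ_ : PS → ℤ → PS
f ^ᶻ (+ n)      = f ^ₛ n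
f ^ᶻ (-[1+ n ]) = inv f ^ₛ suc n

-- Laurent polynomials in r over ℚ, as formal sums of terms q r^k given by
-- (q , k), and power series with such coefficients: ℚ[r,r⁻¹][[y₀,y₁,…]].

Laurent : Set
Laurent = List (ℚ × ℤ)

LSeries : Set
LSeries = Series Laurent

_+ₗ_ : LSeries → LSeries → LSeries
_+ₗ_ = zipWithS _++_

0ₗ : LSeries
0ₗ = constS [] []

scaleₗ : ℚ → LSeries → LSeries
scaleₗ q = mapS (List.map λ (a , k) → (q ℚ.* a , k))

shiftₗ : ℤ → LSeries → LSeries
shiftₗ k = mapS (List.map λ (a , l) → (a , k ℤ.+ l))

r∂r : LSeries → LSeries
r∂r = mapS (List.map λ (a , k) → (fromℤ k ℚ.* a , k))

Operator-rawSemiring : RawSemiring 0ℓ 0ℓ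
Operator-rawSemiring = record
  { Carrier = LSeries → LSeries
  ; _≈_     = λ D E → ∀ F → D F ≈ E F
  ; _+_     = λ D E F → D F +ₗ E F
  ; _*_     = λ D E → D ∘ E
  ; 0#      = λ _ → 0ₗ
  ; 1#      = id
  }

evalLaurent : Laurent → PS → PS
evalLaurent []            R = 0ₛ
evalLaurent ((a , k) ∷ L) R = a ·ₛ (R ^ᶻ k) +ₛ evalLaurent L R

-- Substitution r = R: if F = ∑_u F_u(r) y^u then F [r= R ] = ∑_u F_u(R) y^u.
_[r=_] : LSeries → PS → PS
(F [r= R ]) .coeff  = convolve λ u v → coeff (evalLaurent (coeff F u) R) v
(F [r= R ]) .padded = convolve-padded _ λ u v →
  trans (cong (λ L → coeff (evalLaurent L R) (v ∷ʳ 0)) (padded F u))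
        (padded (evalLaurent (coeff F u) R) v)

-- From here on, for given b, the variable y_i is x_{b+i}; in particular y₀ is
-- x_b, on which Z b does not depend, and ∂ is the derivative in x_b.

Cat : ℕ → ℚ
Cat ℓ = (+ ((2 ℕ.* ℓ) C ℓ)) / suc ℓ

Z : ℕ → LSeries
Z b = constS [] (leading b ++ List.map constTerm (upTo (suc b))) +ₗ linearS [] xTerm
  where
  leading : ℕ → Laurent
  leading zero    = (1ℚ , + 1) ∷ []
  leading (suc _) = []

  constTerm : ℕ → ℚ × ℤ
  constTerm ℓ =
    ( ℚ.- ((ℚ.- 1ℚ) ^ℚ (b ∸ ℓ) ℚ.* fromℕ ((b ℕ.+ ℓ) C (2 ℕ.* ℓ)) ℚ.* Cat ℓ)
    , + (b ∸ ℓ) )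

  xTerm : ℕ → Laurent
  xTerm zero    = []
  xTerm (suc i) = (ℚ.- fromℕ ((2 ℕ.* j ∸ 1) C (j ℕ.+ b)) , + (b ℕ.+ j)) ∷ []
    where j = b ℕ.+ suc i

-- R is the series R⁽ᵇ⁾, which these conditions determine uniquely.
record IsR (b : ℕ) (R : PS) : Set where
  field
    constantTerm≡1 : constantTerm R ≡ 1ℚ
    Z[R]≈x_b       : Z b [r= R ] ≈ y₀

-- Q is the polynomial Q_p, its two variables being b and j in this order.  The
-- values at all integers j > b ≥ 0 determine Q as a polynomial.
IsQ : ℕ → Polynomial 2 → Set
IsQ p Q = ∀ b j → b < j →
  ∑ (j ∸ b) (λ i → let k = b ℕ.+ i in
    fromℕ ((2 ℕ.* k ℕ.+ 1 ℕ.+ p) C (2 ℕ.* p ℕ.+ 1))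
      ℚ.* fromℕ ((2 ℕ.* j ∸ 1) C (j ℕ.+ k)))
  ≡ fromℕ ((2 ℕ.* j ∸ 1) C (j ℕ.+ b))
      ℚ.* eval +-*-rawSemiring id Q (fromℕ b ∷ fromℕ j ∷ [])

-- M̄_p⁽ᵇ⁾, given Q = Q_p and R = R⁽ᵇ⁾.
M̄ : Polynomial 2 → ℕ → PS → PS
M̄ Q b R = Q[b,r∂r] (shiftₗ (ℤ.- (+ b)) (Z b)) [r= R ]
  where
  Q[b,r∂r] : LSeries → LSeries
  Q[b,r∂r] = eval Operator-rawSemiring scaleₗ Q (scaleₗ (fromℕ b) ∷ r∂r ∷ [])

-- T(b, R, ∂R, …, ∂ⁿ⁻¹R)
evalAtDerivatives : ∀ {n} → Polynomial (suc n) → ℕ → PS → PS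
evalAtDerivatives T b R =
  eval PS-rawSemiring ratS T (ratS (fromℕ b) ∷ Vec.tabulate λ i → ∂^ (toℕ i) R)

module Submission where

-- Write D = r ∂_r, let ′ be the derivative in x_b, and for a function w of the
-- exponent k of r let ⟨w⟩ be w(D) Z⁽ᵇ⁾ evaluated at r = R.  Since ⟨1⟩ = x_b and
-- Z⁽ᵇ⁾ does not involve x_b, the chain rule reads R ⟨w⟩′ = R′ ⟨k w⟩.  Hence
-- ⟨k⟩ = R/R′, and applying (R/R′) ∂_{x_b} repeatedly shows by induction that
-- ⟨kⁿ⁺¹⟩ R′²ⁿ⁺¹ / R is a differential polynomial in R, homogeneous of degree 2n
-- and of order n + 1.  Moreover M̄_p = R⁻ᵇ ⟨Q_p(b, k − b)⟩, so it remains to see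
-- that Q_p(b, j) = (j + b) η(b, j) with η of degree at most p in j.  This comes
-- from summation by parts: with hₙ(k) = (2k+1) ∏_{1≤i≤n} (k(k+1) − i(i−1)) and
-- fₙ(k) = ∏_{0≤i<n} (k² − i²), the sums of hₙ(k) C(2j−1, j+k) equal
-- C(2j−1, j+b) (j+b) ηₙ(b, j), where ηₙ₊₁ = fₙ₊₁(b) + (n+1)(j−n−1) ηₙ, and the
-- binomial coefficient C(2k+1+p, 2p+1) is a combination of h₀, …, h_p.

open import Defs
open import Algebra.Bundles using (CommutativeRing)
import Algebra.Definitions.RawSemiring as RawSemiringDefs
import Algebra.Properties.AbelianGroup as AbelianGroupProperties
import Algebra.Properties.CommutativeSemigroup as CommutativeSemigroupProperties
import Algebra.Solver.CommutativeMonoid as CommutativeMonoidSolver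
open import Data.Fin.Base using (Fin; toℕ; fromℕ<) renaming (zero to fzero; suc to fsuc)
open import Data.Fin.Properties using (toℕ-fromℕ<; toℕ<n)
open import Data.Integer.Base as ℤ using (ℤ; +_; -[1+_])
import Data.Integer.Properties as ℤ
open import Data.List.Base as List using ([]; _∷_; _∷ʳ_; _++_)
open import Data.List.Relation.Unary.All using ([]; _∷_)
open import Data.List.Relation.Unary.All.Properties using (++⁺)
open import Data.Nat.Base as ℕ using (ℕ; zero; suc; _∸_; _<_; _≤_; z≤n; s≤s)
import Data.Nat.Properties as ℕ
open import Data.Product.Base using (Σ; ∃-syntax; _×_; _,_; proj₂)
open import Data.Rational.Base as ℚ using (ℚ; 0ℚ; 1ℚ; +-*-rawSemiring)
import Data.Rational.Properties as ℚ
open import Data.Rational.Solver using (module +-*-Solver)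
import Data.Rational.Unnormalised.Base as ℚᵘ
import Data.Rational.Unnormalised.Properties as ℚᵘ
open import Data.Vec.Base as Vec using (Vec; []; _∷_)
open import Data.Vec.Properties using (lookup∘tabulate)
open import Function.Base using (_∘_; id)
open import Level using (0ℓ)
open import Relation.Binary.PropositionalEquality hiding (J)
import Relation.Binary.Reasoning.Setoid as SetoidReasoning
open import Relation.Nullary.Decidable using (yes; no)
open import Relation.Nullary.Negation using (contradiction)
open +-*-Solver using (solve; _:=_; _:+_; _:*_; _:-_; :-_; con)

module _ where
  open import Data.Nat.Combinatorics
    using (_C_; nCk+nC[k+1]≡[n+1]C[k+1]; nCk≡nC[n∸k]; nCn≡1; nC1≡n; k>n⇒nCk≡0)
  open import Data.Rational.Base using (_+_; _*_; _-_; -_)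
  open ≡-Reasoning

  -- Rational numbers and binomial coefficients

  fromℤ-+ : ∀ x y → fromℤ (x ℤ.+ y) ≡ fromℤ x + fromℤ y
  fromℤ-+ x y = trans (ℚ.fromℚᵘ-cong {ℚᵘ.mkℚᵘ (x ℤ.+ y) 0} {ℚᵘ.mkℚᵘ x 0 ℚᵘ.+ ℚᵘ.mkℚᵘ y 0}
      (ℚᵘ.*≡* (cong (ℤ._* ℤ.1ℤ) (sym (cong₂ ℤ._+_ (ℤ.*-identityʳ x) (ℤ.*-identityʳ y))))))
    (ℚ.toℚᵘ-injective (ℚᵘ.≃-trans (ℚ.toℚᵘ-fromℚᵘ _) (ℚᵘ.≃-sym (ℚᵘ.≃-trans (ℚ.toℚᵘ-homo-+ (fromℤ x) (fromℤ y))
      (ℚᵘ.+-cong (ℚ.toℚᵘ-fromℚᵘ (ℚᵘ.mkℚᵘ x 0)) (ℚ.toℚᵘ-fromℚᵘ (ℚᵘ.mkℚᵘ y 0)))))))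

  fromℤ-injective : ∀ {x y} → fromℤ x ≡ fromℤ y → x ≡ y
  fromℤ-injective {x} {y} eq with ℚ./-injective-≃ (ℚᵘ.mkℚᵘ x 0) (ℚᵘ.mkℚᵘ y 0) eq
  ... | ℚᵘ.*≡* e = trans (sym (ℤ.*-identityʳ x)) (trans e (ℤ.*-identityʳ y))

  fromℕ-+ : ∀ m n → fromℕ (m ℕ.+ n) ≡ fromℕ m + fromℕ n
  fromℕ-+ m n = fromℤ-+ (+ m) (+ n)

  fromℕ-suc : ∀ n → fromℕ (suc n) ≡ 1ℚ + fromℕ n
  fromℕ-suc n = fromℕ-+ 1 n

  fromℕ-injective : ∀ {m n} → fromℕ m ≡ fromℕ n → m ≡ n
  fromℕ-injective eq = ℤ.+-injective (fromℤ-injective eq)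

  ∑-zero : ∀ n {f} → (∀ i → f i ≡ 0ℚ) → ∑ n f ≡ 0ℚ
  ∑-zero zero    eq = refl
  ∑-zero (suc n) eq = trans (cong₂ _+_ (eq 0) (∑-zero n (eq ∘ suc))) refl

  ∑-+ : ∀ n f g → ∑ n (λ i → f i + g i) ≡ ∑ n f + ∑ n g
  ∑-+ zero    f g = refl
  ∑-+ (suc n) f g = begin
    f 0 + g 0 + ∑ n (λ i → f (suc i) + g (suc i))       ≡⟨ cong (λ z → f 0 + g 0 + z) (∑-+ n (f ∘ suc) (g ∘ suc)) ⟩
    f 0 + g 0 + (∑ n (f ∘ suc) + ∑ n (g ∘ suc))         ≡⟨ solve 4 (λ a b c d → a :+ b :+ (c :+ d) := a :+ c :+ (b :+ d)) refl (f 0) (g 0) _ _ ⟩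
    f 0 + ∑ n (f ∘ suc) + (g 0 + ∑ n (g ∘ suc))         ∎

  ∑-* : ∀ n q f → ∑ n (λ i → q * f i) ≡ q * ∑ n f
  ∑-* zero    q f = sym (ℚ.*-zeroʳ q)
  ∑-* (suc n) q f = trans (cong (λ z → q * f 0 + z) (∑-* n q (f ∘ suc))) (sym (ℚ.*-distribˡ-+ q (f 0) _))

  ∑-suc : ∀ n f → ∑ (suc n) f ≡ ∑ n f + f n
  ∑-suc zero    f = trans (ℚ.+-identityʳ (f 0)) (sym (ℚ.+-identityˡ (f 0)))
  ∑-suc (suc n) f = trans (cong (λ z → f 0 + z) (∑-suc n (f ∘ suc))) (sym (ℚ.+-assoc (f 0) _ _))

  nC0≡1 : ∀ n → n C 0 ≡ 1
  nC0≡1 n = trans (nCk≡nC[n∸k] {0} {n} z≤n) (nCn≡1 n)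

  pascal : ∀ n k → fromℕ (suc n C suc k) ≡ fromℕ (n C k) + fromℕ (n C suc k)
  pascal n k = trans (cong fromℕ (sym (nCk+nC[k+1]≡[n+1]C[k+1] n k))) (fromℕ-+ (n C k) (n C suc k))

  absorption : ∀ n k → fromℕ (suc k) * fromℕ (n C suc k) ≡ (fromℕ n - fromℕ k) * fromℕ (n C k)
  absorption zero    zero    = refl
  absorption zero    (suc k) = trans (ℚ.*-zeroʳ (fromℕ (suc (suc k)))) (sym (ℚ.*-zeroʳ (fromℕ 0 - fromℕ (suc k))))
  absorption (suc n) zero    = begin
    1ℚ * fromℕ (suc n C 1)                        ≡⟨ cong (λ c → 1ℚ * fromℕ c) (nC1≡n (suc n)) ⟩
    1ℚ * fromℕ (suc n)                            ≡⟨ solve 1 (λ x → con 1ℚ :* x := (x :- con 0ℚ) :* con 1ℚ) refl (fromℕ (suc n)) ⟩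
    (fromℕ (suc n) - 0ℚ) * 1ℚ                     ≡⟨ cong (λ c → (fromℕ (suc n) - 0ℚ) * fromℕ c) (nC0≡1 (suc n)) ⟨
    (fromℕ (suc n) - 0ℚ) * fromℕ (suc n C 0)      ∎
  absorption (suc n) (suc k) = begin
    fromℕ (2 ℕ.+ k) * fromℕ (suc n C (2 ℕ.+ k))    ≡⟨ cong (fromℕ (2 ℕ.+ k) *_) (pascal n (suc k)) ⟩
    fromℕ (2 ℕ.+ k) * (c₁ + c₂)                    ≡⟨ ℚ.*-distribˡ-+ (fromℕ (2 ℕ.+ k)) c₁ c₂ ⟩
    fromℕ (2 ℕ.+ k) * c₁ + fromℕ (2 ℕ.+ k) * c₂    ≡⟨ cong₂ (λ x y → x * c₁ + y) (fromℕ-suc (suc k)) (absorption n (suc k)) ⟩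
    (1ℚ + K₁) * c₁ + (N - K₁) * c₁                 ≡⟨ cong (λ x → (1ℚ + x) * c₁ + (N - x) * c₁) (fromℕ-suc k) ⟩
    (1ℚ + (1ℚ + K)) * c₁ + (N - (1ℚ + K)) * c₁     ≡⟨ solve 3 (λ n k c → (con 1ℚ :+ (con 1ℚ :+ k)) :* c :+ (n :- (con 1ℚ :+ k)) :* c
                                                           := (con 1ℚ :+ k) :* c :+ (n :- k) :* c) refl N K c₁ ⟩
    (1ℚ + K) * c₁ + (N - K) * c₁                   ≡⟨ cong (λ x → x * c₁ + (N - K) * c₁) (fromℕ-suc k) ⟨
    K₁ * c₁ + (N - K) * c₁                         ≡⟨ cong (_+ (N - K) * c₁) (absorption n k) ⟩
    (N - K) * c₀ + (N - K) * c₁                    ≡⟨ solve 4 (λ n k a b → (n :- k) :* a :+ (n :- k) :* b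
                                                           := (con 1ℚ :+ n :- (con 1ℚ :+ k)) :* (a :+ b)) refl N K c₀ c₁ ⟩
    (1ℚ + N - (1ℚ + K)) * (c₀ + c₁)                ≡⟨ cong₂ (λ x y → (x - y) * (c₀ + c₁)) (fromℕ-suc n) (fromℕ-suc k) ⟨
    (fromℕ (suc n) - K₁) * (c₀ + c₁)               ≡⟨ cong ((fromℕ (suc n) - K₁) *_) (pascal n k) ⟨
    (fromℕ (suc n) - K₁) * fromℕ (suc n C suc k)   ∎
    where
    N  = fromℕ n
    K  = fromℕ k
    K₁ = fromℕ (suc k)
    c₀ = fromℕ (n C k)
    c₁ = fromℕ (n C suc k)
    c₂ = fromℕ (n C suc (suc k))

  absorption′ : ∀ n k → fromℕ (suc k) * fromℕ (suc n C suc k) ≡ fromℕ (suc n) * fromℕ (n C k)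
  absorption′ n k = begin
    fromℕ (suc k) * fromℕ (suc n C suc k)          ≡⟨ cong (fromℕ (suc k) *_) (pascal n k) ⟩
    fromℕ (suc k) * (c₀ + c₁)                      ≡⟨ ℚ.*-distribˡ-+ (fromℕ (suc k)) c₀ c₁ ⟩
    fromℕ (suc k) * c₀ + fromℕ (suc k) * c₁        ≡⟨ cong₂ (λ x y → x * c₀ + y) (fromℕ-suc k) (absorption n k) ⟩
    (1ℚ + K) * c₀ + (N - K) * c₀                   ≡⟨ solve 3 (λ n k c → (con 1ℚ :+ k) :* c :+ (n :- k) :* c := (con 1ℚ :+ n) :* c) refl N K c₀ ⟩
    (1ℚ + N) * c₀                                  ≡⟨ cong (_* c₀) (fromℕ-suc n) ⟨
    fromℕ (suc n) * c₀                             ∎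
    where
    N  = fromℕ n
    K  = fromℕ k
    c₀ = fromℕ (n C k)
    c₁ = fromℕ (n C suc k)

  nCk≢0 : ∀ {n k} → k ≤ n → n C k ≢ 0
  nCk≢0 {n} z≤n eq with () ← trans (sym (nC0≡1 n)) eq
  nCk≢0 {suc n} {suc k} (s≤s k≤n) eq =
    nCk≢0 k≤n (ℕ.m+n≡0⇒m≡0 (n C k) (trans (nCk+nC[k+1]≡[n+1]C[k+1] n k) eq))

  recip-inverseʳ : ∀ {q} → q ≢ 0ℚ → q * recip q ≡ 1ℚ
  recip-inverseʳ {q} q≢0 with q ℚ.≟ 0ℚ
  ... | yes q≡0 = contradiction q≡0 q≢0
  ... | no  q≢0 = ℚ.*-inverseʳ q {{ℚ.≢-nonZero q≢0}}

  *-cancelˡ : ∀ {q x y} → q ≢ 0ℚ → q * x ≡ q * y → x ≡ y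
  *-cancelˡ {q} {x} {y} q≢0 eq = trans (lemma x) (trans (cong (recip q *_) eq) (sym (lemma y)))
    where
    lemma : ∀ x → x ≡ recip q * (q * x)
    lemma x = trans (sym (ℚ.*-identityˡ x)) (trans (cong (_* x) (sym (recip-inverseʳ q≢0)))
      (solve 3 (λ q r x → q :* r :* x := r :* (q :* x)) refl q (recip q) x))

  fromℕ-suc≢0 : ∀ n → fromℕ (suc n) ≢ 0ℚ
  fromℕ-suc≢0 n eq with () ← fromℕ-injective {suc n} {0} eq

  -- Polynomial functions of degree less than n, characterised by their divided
  -- differences.
  PolyFun : ℕ → (ℚ → ℚ) → Set
  PolyFun zero    f = ∀ x → f x ≡ 0ℚ
  PolyFun (suc n) f = ∀ a → Σ (ℚ → ℚ) λ g → PolyFun n g × (∀ x → f x ≡ f a + (x - a) * g x)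

  PolyFun-cong : ∀ n {f g} → (∀ x → f x ≡ g x) → PolyFun n f → PolyFun n g
  PolyFun-cong zero    eq F   = λ x → trans (sym (eq x)) (F x)
  PolyFun-cong (suc n) eq F a with F a
  ... | h , H , e = h , H , λ x → trans (sym (eq x)) (trans (e x) (cong (_+ (x - a) * h x) (eq a)))

  PolyFun-suc : ∀ n {f} → PolyFun n f → PolyFun (suc n) f
  PolyFun-suc zero    F a = (λ _ → 0ℚ) , (λ _ → refl) , λ x →
    trans (F x) (trans (solve 1 (λ y → con 0ℚ := con 0ℚ :+ y :* con 0ℚ) refl (x - a)) (cong (_+ (x - a) * 0ℚ) (sym (F a))))
  PolyFun-suc (suc n) F a with F a
  ... | g , G , e = g , PolyFun-suc n G , e

  PolyFun-+ : ∀ n {f g} → PolyFun n f → PolyFun n g → PolyFun n (λ x → f x + g x)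
  PolyFun-+ zero    F G   = λ x → cong₂ _+_ (F x) (G x)
  PolyFun-+ (suc n) {f} {g} F G a with F a | G a
  ... | f′ , F′ , e | g′ , G′ , e′ = (λ x → f′ x + g′ x) , PolyFun-+ n F′ G′ , λ x →
    trans (cong₂ _+_ (e x) (e′ x))
      (solve 5 (λ a b y c d → a :+ y :* c :+ (b :+ y :* d) := a :+ b :+ y :* (c :+ d)) refl (f a) (g a) (x - a) (f′ x) (g′ x))

  PolyFun-scale : ∀ n q {f} → PolyFun n f → PolyFun n (λ x → q * f x)
  PolyFun-scale zero    q F = λ x → trans (cong (q *_) (F x)) (ℚ.*-zeroʳ q)
  PolyFun-scale (suc n) q {f} F a with F a
  ... | g , G , e = (λ x → q * g x) , PolyFun-scale n q G , λ x → trans (cong (q *_) (e x))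
    (solve 4 (λ q a y c → q :* (a :+ y :* c) := q :* a :+ y :* (q :* c)) refl q (f a) (x - a) (g x))

  PolyFun-X* : ∀ n {f} → PolyFun n f → PolyFun (suc n) (λ x → x * f x)
  PolyFun-X* zero    F   = PolyFun-suc zero λ x → trans (cong (x *_) (F x)) (ℚ.*-zeroʳ x)
  PolyFun-X* (suc n) {f} F a with F a
  ... | g , G , e = (λ x → f x + a * g x) ,
    PolyFun-+ (suc n) F (PolyFun-scale (suc n) a (PolyFun-suc n G)) , λ x →
    trans (solve 3 (λ x a y → x :* y := a :* y :+ (x :- a) :* y) refl x a (f x))
     (trans (cong (λ z → a * z + (x - a) * f x) (e x))
       (solve 5 (λ x a b c d → a :* (b :+ (x :- a) :* c) :+ (x :- a) :* d := a :* b :+ (x :- a) :* (d :+ a :* c)) refl x a (f a) (g x) (f x)))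

  IsPolyFun : (ℚ → ℚ) → Set
  IsPolyFun f = Σ ℕ λ n → PolyFun n f

  PolyFun-≤ : ∀ {m n f} → m ≤ n → PolyFun m f → PolyFun n f
  PolyFun-≤ m≤n = go (ℕ.≤⇒≤′ m≤n)
    where
    go : ∀ {m n f} → m ℕ.≤′ n → PolyFun m f → PolyFun n f
    go ℕ.≤′-refl       F = F
    go (ℕ.≤′-step m≤n) F = PolyFun-suc _ (go m≤n F)

  isPolyFun-+ : ∀ {f g} → IsPolyFun f → IsPolyFun g → IsPolyFun (λ x → f x + g x)
  isPolyFun-+ (m , F) (n , G) = m ℕ.+ n , PolyFun-+ (m ℕ.+ n) (PolyFun-≤ (ℕ.m≤m+n m n) F) (PolyFun-≤ (ℕ.m≤n+m n m) G)

  isPolyFun-scale : ∀ q {f} → IsPolyFun f → IsPolyFun (λ x → q * f x)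
  isPolyFun-scale q (n , F) = n , PolyFun-scale n q F

  isPolyFun-X* : ∀ {f} → IsPolyFun f → IsPolyFun (λ x → x * f x)
  isPolyFun-X* (n , F) = suc n , PolyFun-X* n F

  isPolyFun-cong : ∀ {f g} → (∀ x → f x ≡ g x) → IsPolyFun f → IsPolyFun g
  isPolyFun-cong eq (n , F) = n , PolyFun-cong n eq F

  isPolyFun-1 : IsPolyFun (λ _ → 1ℚ)
  isPolyFun-1 = 1 , λ a → (λ _ → 0ℚ) , (λ _ → refl) , λ x → solve 1 (λ y → con 1ℚ := con 1ℚ :+ y :* con 0ℚ) refl (x - a)

  PolyFun-vanish : ∀ n {f} a → PolyFun n f → (∀ j → a ≤ j → f (fromℕ j) ≡ 0ℚ) → ∀ x → f x ≡ 0ℚ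
  PolyFun-vanish zero    a F eq x = F x
  PolyFun-vanish (suc n) {f} a F eq x with F (fromℕ a)
  ... | g , G , e = trans (e x) (trans (cong₂ (λ u v → u + (x - fromℕ a) * v) (eq a ℕ.≤-refl) (PolyFun-vanish n (suc a) G zeros x))
                       (solve 1 (λ y → con 0ℚ :+ y :* con 0ℚ := con 0ℚ) refl (x - fromℕ a)))
    where
    zeros : ∀ j → suc a ≤ j → g (fromℕ j) ≡ 0ℚ
    zeros j a<j = *-cancelˡ d≢0 (begin
      (fromℕ j - fromℕ a) * g (fromℕ j)              ≡⟨ ℚ.+-identityˡ _ ⟨
      0ℚ + (fromℕ j - fromℕ a) * g (fromℕ j)         ≡⟨ cong (_+ (fromℕ j - fromℕ a) * g (fromℕ j)) (eq a ℕ.≤-refl) ⟨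
      f (fromℕ a) + (fromℕ j - fromℕ a) * g (fromℕ j) ≡⟨ e (fromℕ j) ⟨
      f (fromℕ j)                                    ≡⟨ eq j (ℕ.<⇒≤ a<j) ⟩
      0ℚ                                             ≡⟨ ℚ.*-zeroʳ (fromℕ j - fromℕ a) ⟨
      (fromℕ j - fromℕ a) * 0ℚ                       ∎)
      where
      d≢0 : fromℕ j - fromℕ a ≢ 0ℚ
      d≢0 d≡0 = ℕ.<⇒≢ a<j (fromℕ-injective (sym (begin
        fromℕ j                           ≡⟨ solve 2 (λ j a → j := j :- a :+ a) refl (fromℕ j) (fromℕ a) ⟩
        fromℕ j - fromℕ a + fromℕ a       ≡⟨ cong (_+ fromℕ a) d≡0 ⟩
        0ℚ + fromℕ a                      ≡⟨ ℚ.+-identityˡ (fromℕ a) ⟩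
        fromℕ a                           ∎)))

  isPolyFun-unique : ∀ {f g} a → IsPolyFun f → IsPolyFun g →
                     (∀ j → a ≤ j → f (fromℕ j) ≡ g (fromℕ j)) → ∀ x → f x ≡ g x
  isPolyFun-unique {f} {g} a F G eq x = begin
    f x                        ≡⟨ solve 2 (λ f g → f := f :+ con (- 1ℚ) :* g :+ g) refl (f x) (g x) ⟩
    f x + - 1ℚ * g x + g x     ≡⟨ cong (_+ g x) (PolyFun-vanish _ a (proj₂ F-G) (λ j a≤j → trans (cong (_+ - 1ℚ * g (fromℕ j)) (eq j a≤j))
                                     (solve 1 (λ y → y :+ con (- 1ℚ) :* y := con 0ℚ) refl (g (fromℕ j)))) x) ⟩
    0ℚ + g x                   ≡⟨ ℚ.+-identityˡ (g x) ⟩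
    g x                        ∎
    where
    F-G : IsPolyFun (λ x → f x + - 1ℚ * g x)
    F-G = isPolyFun-+ F (isPolyFun-scale (- 1ℚ) G)

  -- The divisibility of Q by b + j

  -- Polynomials in two variables b and j, of degree at most n in j.
  infixl 6 _⊕_
  infixr 7 _⊙_ b⊙_ j⊙_

  data BPoly : ℕ → Set where
    one    : BPoly 0
    _⊕_    : ∀ {n} → BPoly n → BPoly n → BPoly n
    _⊙_    : ∀ {n} → ℚ → BPoly n → BPoly n
    b⊙_    : ∀ {n} → BPoly n → BPoly n
    j⊙_    : ∀ {n} → BPoly n → BPoly (suc n)
    raise  : ∀ {n} → BPoly n → BPoly (suc n)

  ⟦_⟧ : ∀ {n} → BPoly n → ℚ → ℚ → ℚ
  ⟦ one     ⟧ β x = 1ℚ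
  ⟦ η ⊕ ζ   ⟧ β x = ⟦ η ⟧ β x + ⟦ ζ ⟧ β x
  ⟦ q ⊙ η   ⟧ β x = q * ⟦ η ⟧ β x
  ⟦ b⊙ η    ⟧ β x = β * ⟦ η ⟧ β x
  ⟦ j⊙ η    ⟧ β x = x * ⟦ η ⟧ β x
  ⟦ raise η ⟧ β x = ⟦ η ⟧ β x

  isPolyFun-⟦⟧ : ∀ {n} (η : BPoly n) β → IsPolyFun (⟦ η ⟧ β)
  isPolyFun-⟦⟧ one       β = isPolyFun-1
  isPolyFun-⟦⟧ (η ⊕ ζ)   β = isPolyFun-+ (isPolyFun-⟦⟧ η β) (isPolyFun-⟦⟧ ζ β)
  isPolyFun-⟦⟧ (q ⊙ η)   β = isPolyFun-scale q (isPolyFun-⟦⟧ η β)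
  isPolyFun-⟦⟧ (b⊙ η)    β = isPolyFun-scale β (isPolyFun-⟦⟧ η β)
  isPolyFun-⟦⟧ (j⊙ η)    β = isPolyFun-X* (isPolyFun-⟦⟧ η β)
  isPolyFun-⟦⟧ (raise η) β = isPolyFun-⟦⟧ η β

  isPolyFun-eval : ∀ (Q : Polynomial 2) β → IsPolyFun (λ x → eval +-*-rawSemiring id Q (β ∷ x ∷ []))
  isPolyFun-eval []                      β = 0 , λ _ → refl
  isPolyFun-eval ((q , d ∷ e ∷ []) ∷ Q) β =
    isPolyFun-+ (isPolyFun-scale q (isPolyFun-scale (β ^ℚ d) (power e))) (isPolyFun-eval Q β)
    where
    power : ∀ e → IsPolyFun (λ x → x ^ℚ e * 1ℚ)
    power zero    = isPolyFun-1
    power (suc e) = isPolyFun-cong (λ x → sym (ℚ.*-assoc x (x ^ℚ e) 1ℚ)) (isPolyFun-X* (power e))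

  -- g n x = ∏_{1≤i≤n} (x(x+1) − i(i−1)),  f n x = ∏_{0≤i<n} (x² − i²).
  g f h : ℕ → ℚ → ℚ
  g zero    x = 1ℚ
  g (suc n) x = g n x * (x * (x + 1ℚ) - (1ℚ + fromℕ n) * fromℕ n)
  f zero    x = 1ℚ
  f (suc n) x = f n x * (x * x - fromℕ n * fromℕ n)
  h n x = (x + x + 1ℚ) * g n x

  f-suc : ∀ n x → f (suc n) x ≡ g n x * (x * (x - fromℕ n))
  f-suc zero    x = solve 1 (λ x → con 1ℚ :* (x :* x :- con 0ℚ :* con 0ℚ) := con 1ℚ :* (x :* (x :- con 0ℚ))) refl x
  f-suc (suc n) x = begin
    f (suc n) x * (x * x - N₁ * N₁)                          ≡⟨ cong₂ (λ a b → a * (x * x - b * b)) (f-suc n x) (fromℕ-suc n) ⟩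
    g n x * (x * (x - N)) * (x * x - (1ℚ + N) * (1ℚ + N))    ≡⟨ solve 3 (λ g x n → g :* (x :* (x :- n)) :* (x :* x :- (con 1ℚ :+ n) :* (con 1ℚ :+ n))
                                                                 := g :* (x :* (x :+ con 1ℚ) :- (con 1ℚ :+ n) :* n) :* (x :* (x :- (con 1ℚ :+ n)))) refl (g n x) x N ⟩
    g (suc n) x * (x * (x - (1ℚ + N)))                       ≡⟨ cong (λ a → g (suc n) x * (x * (x - a))) (fromℕ-suc n) ⟨
    g (suc n) x * (x * (x - N₁))                             ∎
    where
    N  = fromℕ n
    N₁ = fromℕ (suc n)

  f-suc′ : ∀ n x → f (suc n) (1ℚ + x) ≡ g n x * ((1ℚ + x) * (1ℚ + x + fromℕ n))
  f-suc′ zero    x = solve 1 (λ x → con 1ℚ :* (x :* x :- con 0ℚ :* con 0ℚ) := con 1ℚ :* (x :* (x :+ con 0ℚ))) refl (1ℚ + x)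
  f-suc′ (suc n) x = begin
    f (suc n) y * (y * y - N₁ * N₁)                          ≡⟨ cong₂ (λ a b → a * (y * y - b * b)) (f-suc′ n x) (fromℕ-suc n) ⟩
    g n x * (y * (y + N)) * (y * y - (1ℚ + N) * (1ℚ + N))    ≡⟨ solve 3 (λ g x n → let y = con 1ℚ :+ x in
                                                                   g :* (y :* (y :+ n)) :* (y :* y :- (con 1ℚ :+ n) :* (con 1ℚ :+ n))
                                                                 := g :* (x :* (x :+ con 1ℚ) :- (con 1ℚ :+ n) :* n) :* (y :* (y :+ (con 1ℚ :+ n)))) refl (g n x) x N ⟩
    g (suc n) x * (y * (y + (1ℚ + N)))                       ≡⟨ cong (λ a → g (suc n) x * (y * (y + a))) (fromℕ-suc n) ⟨
    g (suc n) x * (y * (y + N₁))                             ∎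
    where
    y  = 1ℚ + x
    N  = fromℕ n
    N₁ = fromℕ (suc n)

  -- The summation by parts step, after dividing by C(2j−1, j+k).
  h-telescope : ∀ n J x → (J + x) * f (suc n) x - (J - x - 1ℚ) * f (suc n) (1ℚ + x)
                          ≡ h (suc n) x + (1ℚ + fromℕ n) * (1ℚ + fromℕ n - J) * h n x
  h-telescope n J x = trans
    (cong₂ (λ a b → (J + x) * a - (J - x - 1ℚ) * b) (f-suc n x) (f-suc′ n x))
    (solve 4 (λ J x n g →
        (J :+ x) :* (g :* (x :* (x :- n))) :- (J :- x :- con 1ℚ) :* (g :* ((con 1ℚ :+ x) :* (con 1ℚ :+ x :+ n)))
        := (x :+ x :+ con 1ℚ) :* (g :* (x :* (x :+ con 1ℚ) :- (con 1ℚ :+ n) :* n))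
           :+ (con 1ℚ :+ n) :* (con 1ℚ :+ n :- J) :* ((x :+ x :+ con 1ℚ) :* g)) refl J x (fromℕ n) (g n x))

  ∑-telescope : ∀ m (F : ℕ → ℚ) → ∑ m (λ i → F i - F (suc i)) ≡ F 0 - F m
  ∑-telescope zero    F = sym (ℚ.+-inverseʳ (F 0))
  ∑-telescope (suc m) F = trans (cong (λ z → F 0 - F 1 + z) (∑-telescope m (F ∘ suc)))
    (solve 3 (λ a b c → a :- b :+ (b :- c) := a :- c) refl (F 0) (F 1) (F (suc m)))

  abstract
    W : ℕ → ℕ → ℚ
    W j k = fromℕ ((2 ℕ.* j ∸ 1) C (j ℕ.+ k))

    W-binomial : ∀ j k → W j k ≡ fromℕ ((2 ℕ.* j ∸ 1) C (j ℕ.+ k))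
    W-binomial j k = refl

    W-step : ∀ j k → 0 < j → (fromℕ j + fromℕ (suc k)) * W j (suc k) ≡ (fromℕ j - fromℕ k - 1ℚ) * W j k
    W-step j@(suc j′) k _ = begin
      (J + fromℕ (suc k)) * W j (suc k)                    ≡⟨ cong₂ (λ a l → a * fromℕ (n C l)) (sym (fromℕ-+ j (suc k))) (ℕ.+-suc j k) ⟩
      fromℕ (j ℕ.+ suc k) * fromℕ (n C suc (j ℕ.+ k))      ≡⟨ cong (λ l → fromℕ l * fromℕ (n C suc (j ℕ.+ k))) (ℕ.+-suc j k) ⟩
      fromℕ (suc (j ℕ.+ k)) * fromℕ (n C suc (j ℕ.+ k))    ≡⟨ absorption n (j ℕ.+ k) ⟩
      (fromℕ n - fromℕ (j ℕ.+ k)) * W j k                  ≡⟨ cong (_* W j k) lemma ⟩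
      (J - fromℕ k - 1ℚ) * W j k                           ∎
      where
      n : ℕ
      n = 2 ℕ.* j ∸ 1
      J : ℚ
      J = fromℕ j
      lemma : fromℕ n - fromℕ (j ℕ.+ k) ≡ J - fromℕ k - 1ℚ
      lemma = begin
        fromℕ n - fromℕ (j ℕ.+ k)            ≡⟨ cong (λ z → fromℕ n - z) (fromℕ-+ j k) ⟩
        fromℕ n - (J + fromℕ k)              ≡⟨ solve 3 (λ n j k → n :- (j :+ k) := con 1ℚ :+ n :- (j :+ k) :- con 1ℚ) refl (fromℕ n) J (fromℕ k) ⟩
        1ℚ + fromℕ n - (J + fromℕ k) - 1ℚ    ≡⟨ cong (λ a → a - (J + fromℕ k) - 1ℚ) (trans (sym (fromℕ-suc n)) (trans (fromℕ-+ j (j ℕ.+ 0)) (cong (λ a → J + fromℕ a) (ℕ.+-identityʳ j)))) ⟩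
        J + J - (J + fromℕ k) - 1ℚ           ≡⟨ solve 2 (λ j k → j :+ j :- (j :+ k) :- con 1ℚ := j :- k :- con 1ℚ) refl J (fromℕ k) ⟩
        J - fromℕ k - 1ℚ                     ∎

    W-diagonal : ∀ j → 0 < j → W j j ≡ 0ℚ
    W-diagonal j@(suc _) _ = cong fromℕ (k>n⇒nCk≡0 {2 ℕ.* j ∸ 1} (ℕ.≤-reflexive (cong (j ℕ.+_) (ℕ.+-identityʳ j))))

    W≢0 : ∀ b j → b < j → W j b ≢ 0ℚ
    W≢0 b j@(suc j′) (s≤s b≤j′) eq = nCk≢0 bound (fromℕ-injective {n = 0} eq)
      where
      bound : j ℕ.+ b ≤ 2 ℕ.* j ∸ 1
      bound = ℕ.≤-trans (ℕ.+-monoʳ-≤ j b≤j′) (ℕ.≤-reflexive (trans (ℕ.+-comm j j′) (cong (λ a → j′ ℕ.+ suc a) (sym (ℕ.+-identityʳ j′)))))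

  summand : (ℚ → ℚ) → ℕ → ℕ → ℕ → ℚ
  summand φ b j i = φ (fromℕ (b ℕ.+ i)) * W j (b ℕ.+ i)

  weightedSum : (ℚ → ℚ) → ℕ → ℕ → ℚ
  weightedSum φ b j = ∑ (j ∸ b) (summand φ b j)

  weightedSum-cong : ∀ {φ ψ} → (∀ x → φ x ≡ ψ x) → ∀ b j → weightedSum φ b j ≡ weightedSum ψ b j
  weightedSum-cong eq b j = ∑-cong (j ∸ b) λ i → cong (_* W j (b ℕ.+ i)) (eq (fromℕ (b ℕ.+ i)))

  weightedSum-+ : ∀ φ ψ b j → weightedSum (λ x → φ x + ψ x) b j ≡ weightedSum φ b j + weightedSum ψ b j
  weightedSum-+ φ ψ b j = trans
    (∑-cong (j ∸ b) λ i → ℚ.*-distribʳ-+ (W j (b ℕ.+ i)) (φ (fromℕ (b ℕ.+ i))) (ψ (fromℕ (b ℕ.+ i))))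
    (∑-+ (j ∸ b) (summand φ b j) (summand ψ b j))

  weightedSum-* : ∀ q φ b j → weightedSum (λ x → q * φ x) b j ≡ q * weightedSum φ b j
  weightedSum-* q φ b j = trans
    (∑-cong (j ∸ b) λ i → ℚ.*-assoc q (φ (fromℕ (b ℕ.+ i))) (W j (b ℕ.+ i)))
    (∑-* (j ∸ b) q (summand φ b j))

  record Summable (n : ℕ) (φ : ℚ → ℚ) : Set where
    constructor _,_
    field
      quotient : BPoly n
      sums     : ∀ b j → b < j → weightedSum φ b j ≡ W j b * ((fromℕ b + fromℕ j) * ⟦ quotient ⟧ (fromℕ b) (fromℕ j))
  open Summable

  summable-cong : ∀ {n φ ψ} → (∀ x → φ x ≡ ψ x) → Summable n φ → Summable n ψ
  summable-cong eq (η , E) = η , λ b j b<j → trans (weightedSum-cong (λ x → sym (eq x)) b j) (E b j b<j)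

  summable-+ : ∀ {n φ ψ} → Summable n φ → Summable n ψ → Summable n (λ x → φ x + ψ x)
  summable-+ {φ = φ} {ψ} (η , E) (ζ , E′) = η ⊕ ζ , λ b j b<j →
    trans (weightedSum-+ φ ψ b j) (trans (cong₂ _+_ (E b j b<j) (E′ b j b<j))
      (solve 4 (λ w s x y → w :* (s :* x) :+ w :* (s :* y) := w :* (s :* (x :+ y))) refl
        (W j b) (fromℕ b + fromℕ j) (⟦ η ⟧ (fromℕ b) (fromℕ j)) (⟦ ζ ⟧ (fromℕ b) (fromℕ j))))

  summable-scale : ∀ {n φ} q → Summable n φ → Summable n (λ x → q * φ x)
  summable-scale {φ = φ} q (η , E) = q ⊙ η , λ b j b<j →
    trans (weightedSum-* q φ b j) (trans (cong (q *_) (E b j b<j))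
      (solve 4 (λ q w s x → q :* (w :* (s :* x)) := w :* (s :* (q :* x))) refl
        q (W j b) (fromℕ b + fromℕ j) (⟦ η ⟧ (fromℕ b) (fromℕ j))))

  summable-raise : ∀ {n φ} → Summable n φ → Summable (suc n) φ
  summable-raise (η , E) = raise η , E

  telescoped : ∀ (F : ℚ → ℚ) (φ : ℚ → ℚ → ℚ) → (∀ J x → (J + x) * F x - (J - x - 1ℚ) * F (1ℚ + x) ≡ φ J x) →
               ∀ b j → b < j → weightedSum (φ (fromℕ j)) b j ≡ W j b * ((fromℕ b + fromℕ j) * F (fromℕ b))
  telescoped F φ eq b j b<j = begin
    weightedSum (φ J) b j                               ≡⟨ ∑-cong (j ∸ b) (λ i → sym (term (b ℕ.+ i))) ⟩
    ∑ (j ∸ b) (λ i → G (b ℕ.+ i) - G (suc (b ℕ.+ i)))   ≡⟨ ∑-cong (j ∸ b) (λ i → cong (λ l → G (b ℕ.+ i) - G l) (sym (ℕ.+-suc b i))) ⟩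
    ∑ (j ∸ b) (λ i → G (b ℕ.+ i) - G (b ℕ.+ suc i))     ≡⟨ ∑-telescope (j ∸ b) (λ i → G (b ℕ.+ i)) ⟩
    G (b ℕ.+ 0) - G (b ℕ.+ (j ∸ b))                     ≡⟨ cong₂ (λ k l → G k - G l) (ℕ.+-identityʳ b) (ℕ.m+[n∸m]≡n (ℕ.<⇒≤ b<j)) ⟩
    G b - G j                                           ≡⟨ cong (λ w → G b - (J + J) * w * F J) (W-diagonal j 0<j) ⟩
    (J + fromℕ b) * W j b * F (fromℕ b) - (J + J) * 0ℚ * F J
      ≡⟨ solve 5 (λ J b w f f′ → (J :+ b) :* w :* f :- (J :+ J) :* con 0ℚ :* f′ := w :* ((b :+ J) :* f)) refl J (fromℕ b) (W j b) (F (fromℕ b)) (F J) ⟩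
    W j b * ((fromℕ b + J) * F (fromℕ b))               ∎
    where
    J : ℚ
    J = fromℕ j
    0<j = ℕ.≤-<-trans z≤n b<j
    G : ℕ → ℚ
    G k = (J + fromℕ k) * W j k * F (fromℕ k)
    term : ∀ k → G k - G (suc k) ≡ φ J (fromℕ k) * W j k
    term k = begin
      G k - (J + fromℕ (suc k)) * W j (suc k) * F (fromℕ (suc k))     ≡⟨ cong₂ (λ a y → G k - a * F y) (W-step j k 0<j) (fromℕ-suc k) ⟩
      G k - (J - fromℕ k - 1ℚ) * W j k * F (1ℚ + fromℕ k)             ≡⟨ solve 5 (λ a c w f f′ → a :* w :* f :- c :* w :* f′ := (a :* f :- c :* f′) :* w) refl
                                                                          (J + fromℕ k) (J - fromℕ k - 1ℚ) (W j k) (F (fromℕ k)) (F (1ℚ + fromℕ k)) ⟩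
      _                                                               ≡⟨ cong (_* W j k) (eq J (fromℕ k)) ⟩
      φ J (fromℕ k) * W j k                                           ∎

  ConstantInJ : ∀ {n} → (F : ℚ → ℚ) → Set
  ConstantInJ {n} F = Σ (BPoly n) λ η → ∀ β x → ⟦ η ⟧ β x ≡ F β

  f-constantInJ : ∀ n {m} → ConstantInJ {m} (f n)
  f-constantInJ zero {zero}  = one , λ _ _ → refl
  f-constantInJ zero {suc m} with f-constantInJ zero {m}
  ... | η , E = raise η , E
  f-constantInJ (suc n) with f-constantInJ n
  ... | η , E = b⊙ b⊙ η ⊕ (- (fromℕ n * fromℕ n)) ⊙ η , λ β x → trans
    (cong (λ a → β * (β * a) + - (fromℕ n * fromℕ n) * a) (E β x))
    (solve 3 (λ β n a → β :* (β :* a) :+ (:- (n :* n)) :* a := a :* (β :* β :- n :* n)) refl β (fromℕ n) (f n β))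

  summable-h : ∀ n → Summable n (h n)
  summable-h zero = one , λ b j → telescoped (λ _ → 1ℚ) (λ J → h 0)
    (λ J x → solve 2 (λ J x → (J :+ x) :* con 1ℚ :- (J :- x :- con 1ℚ) :* con 1ℚ := (x :+ x :+ con 1ℚ) :* con 1ℚ) refl J x) b j
  summable-h (suc n) = step (summable-h n) (f-constantInJ (suc n))
    where
    N : ℚ
    N = 1ℚ + fromℕ n
    φ ψ : ℚ → ℚ → ℚ
    φ J x = h (suc n) x + N * (N - J) * h n x
    ψ J x = N * (J - N) * h n x
    split : ∀ J x → h (suc n) x ≡ φ J x + ψ J x
    split J x = solve 4 (λ a n J c → a := a :+ n :* (n :- J) :* c :+ n :* (J :- n) :* c) refl (h (suc n) x) N J (h n x)
    algebra : ∀ β J w y F {s₀ s₁ s₂ s₃ s₄} → s₀ ≡ s₁ → s₁ ≡ s₂ + s₃ → s₂ ≡ w * ((β + J) * f (suc n) β) → F ≡ f (suc n) β →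
              s₃ ≡ N * (J - N) * s₄ → s₄ ≡ w * ((β + J) * y) → s₀ ≡ w * ((β + J) * (F + (N * (J * y) + - (N * N) * y)))
    algebra β J w y F refl refl refl refl refl refl =
      solve 6 (λ w b J f n y → w :* ((b :+ J) :* f) :+ n :* (J :- n) :* (w :* ((b :+ J) :* y))
            := w :* ((b :+ J) :* (f :+ (n :* (J :* y) :+ (:- (n :* n)) :* y)))) refl w β J F N y
    step : Summable n (h n) → ConstantInJ {suc n} (f (suc n)) → Summable (suc n) (h (suc n))
    step (η , E) (F , EF) = F ⊕ (N ⊙ j⊙ η ⊕ (- (N * N)) ⊙ raise η) , λ b j b<j →
      algebra (fromℕ b) (fromℕ j) (W j b) (⟦ η ⟧ (fromℕ b) (fromℕ j)) (⟦ F ⟧ (fromℕ b) (fromℕ j))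
        (weightedSum-cong (split (fromℕ j)) b j) (weightedSum-+ (φ (fromℕ j)) (ψ (fromℕ j)) b j)
        (telescoped (f (suc n)) φ (h-telescope n) b j b<j)
        (EF (fromℕ b) (fromℕ j))
        (weightedSum-* (N * (fromℕ j - N)) (h n) b j) (E b j b<j)

  -- oddProduct p x = ∏_{1≤i≤p} ((2x+1)² − i²)
  oddProduct : ℕ → ℚ → ℚ
  oddProduct zero    x = 1ℚ
  oddProduct (suc p) x = oddProduct p x * ((x + x + 1ℚ) * (x + x + 1ℚ) - (1ℚ + fromℕ p) * (1ℚ + fromℕ p))

  summable-h-oddProduct : ∀ p n → Summable (p ℕ.+ n) (λ x → h n x * oddProduct p x)
  summable-h-oddProduct zero    n = summable-cong (λ x → sym (ℚ.*-identityʳ (h n x))) (summable-h n)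
  summable-h-oddProduct (suc p) n = summable-cong (λ x → sym (step x))
    (summable-+ (summable-scale c₁ (subst (λ m → Summable m (λ x → h (suc n) x * oddProduct p x)) (ℕ.+-suc p n) (summable-h-oddProduct p (suc n))))
                (summable-scale c₂ (summable-raise (summable-h-oddProduct p n))))
    where
    N = fromℕ n
    P = 1ℚ + fromℕ p
    c₁ = fromℕ 4
    c₂ = fromℕ 4 * ((1ℚ + N) * N) + 1ℚ - P * P
    step : ∀ x → h n x * oddProduct (suc p) x ≡ c₁ * (h (suc n) x * oddProduct p x) + c₂ * (h n x * oddProduct p x)
    step x = solve 5 (λ x g o n P →
        (x :+ x :+ con 1ℚ) :* g :* (o :* ((x :+ x :+ con 1ℚ) :* (x :+ x :+ con 1ℚ) :- P :* P))
        := con (fromℕ 4) :* ((x :+ x :+ con 1ℚ) :* (g :* (x :* (x :+ con 1ℚ) :- (con 1ℚ :+ n) :* n)) :* o)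
           :+ (con (fromℕ 4) :* ((con 1ℚ :+ n) :* n) :+ con 1ℚ :- P :* P) :* ((x :+ x :+ con 1ℚ) :* g :* o)) refl x (g n x) (oddProduct p x) N P

  fromℕ-2n+1 : ∀ n → fromℕ (2 ℕ.* n ℕ.+ 1) ≡ fromℕ n + fromℕ n + 1ℚ
  fromℕ-2n+1 n = trans (fromℕ-+ (2 ℕ.* n) 1)
    (cong (_+ 1ℚ) (trans (fromℕ-+ n (n ℕ.+ 0)) (cong (λ l → fromℕ n + fromℕ l) (ℕ.+-identityʳ n))))

  binomial-oddProduct : ∀ p → Σ ℚ λ c → ∀ k →
    fromℕ ((2 ℕ.* k ℕ.+ 1 ℕ.+ p) C (2 ℕ.* p ℕ.+ 1)) ≡ c * (h 0 (fromℕ k) * oddProduct p (fromℕ k))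
  binomial-oddProduct zero = 1ℚ , λ k → begin
    fromℕ ((2 ℕ.* k ℕ.+ 1 ℕ.+ 0) C 1)            ≡⟨ cong fromℕ (nC1≡n (2 ℕ.* k ℕ.+ 1 ℕ.+ 0)) ⟩
    fromℕ (2 ℕ.* k ℕ.+ 1 ℕ.+ 0)                  ≡⟨ cong fromℕ (ℕ.+-identityʳ (2 ℕ.* k ℕ.+ 1)) ⟩
    fromℕ (2 ℕ.* k ℕ.+ 1)                        ≡⟨ fromℕ-2n+1 k ⟩
    fromℕ k + fromℕ k + 1ℚ                       ≡⟨ solve 1 (λ x → x :+ x :+ con 1ℚ := con 1ℚ :* ((x :+ x :+ con 1ℚ) :* con 1ℚ :* con 1ℚ)) refl (fromℕ k) ⟩
    1ℚ * ((fromℕ k + fromℕ k + 1ℚ) * 1ℚ * 1ℚ)    ∎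
  binomial-oddProduct (suc p) = step (binomial-oddProduct p)
    where
    K : ℕ
    K = 2 ℕ.* p ℕ.+ 1
    P A B : ℚ
    P = fromℕ p
    A = fromℕ (suc (suc K))
    B = fromℕ (suc K)
    A≢0 : A ≢ 0ℚ
    A≢0 = fromℕ-suc≢0 (suc K)
    B≢0 : B ≢ 0ℚ
    B≢0 = fromℕ-suc≢0 K

    descend : ∀ N x → fromℕ N ≡ x + x + 1ℚ + P →
              B * (A * fromℕ (suc N C suc (suc K))) ≡ (x + x - P) * ((1ℚ + (x + x + 1ℚ + P)) * fromℕ (N C K))
    descend N x N≡ = begin
      B * (A * fromℕ (suc N C suc (suc K)))                    ≡⟨ cong (B *_) (absorption (suc N) (suc K)) ⟩
      B * ((fromℕ (suc N) - B) * fromℕ (suc N C suc K))        ≡⟨ swap B (fromℕ (suc N) - B) (fromℕ (suc N C suc K)) ⟩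
      (fromℕ (suc N) - B) * (B * fromℕ (suc N C suc K))        ≡⟨ cong ((fromℕ (suc N) - B) *_) (absorption′ N K) ⟩
      (fromℕ (suc N) - B) * (fromℕ (suc N) * fromℕ (N C K))    ≡⟨ cong₂ (λ n b → (n - b) * (n * fromℕ (N C K)))
                                                                    (trans (fromℕ-suc N) (cong (λ z → 1ℚ + z) N≡))
                                                                    (trans (fromℕ-suc K) (cong (λ z → 1ℚ + z) (fromℕ-2n+1 p))) ⟩
      (1ℚ + (x + x + 1ℚ + P) - (1ℚ + (P + P + 1ℚ))) * ((1ℚ + (x + x + 1ℚ + P)) * fromℕ (N C K))
        ≡⟨ cong (_* ((1ℚ + (x + x + 1ℚ + P)) * fromℕ (N C K)))
             (solve 2 (λ x P → con 1ℚ :+ (x :+ x :+ con 1ℚ :+ P) :- (con 1ℚ :+ (P :+ P :+ con 1ℚ)) := x :+ x :- P) refl x P) ⟩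
      (x + x - P) * ((1ℚ + (x + x + 1ℚ + P)) * fromℕ (N C K))  ∎
      where
      swap : ∀ a b c → a * (b * c) ≡ b * (a * c)
      swap = solve 3 (λ a b c → a :* (b :* c) := b :* (a :* c)) refl

    regroup : ∀ x c o z A B A′ B′ P → A * A′ ≡ 1ℚ → B * B′ ≡ 1ℚ → z ≡ c * ((x + x + 1ℚ) * 1ℚ * o) →
              (x + x - P) * ((1ℚ + (x + x + 1ℚ + P)) * z)
              ≡ B * (A * (c * (A′ * B′) * ((x + x + 1ℚ) * 1ℚ * (o * ((x + x + 1ℚ) * (x + x + 1ℚ) - (1ℚ + P) * (1ℚ + P))))))
    regroup x c o z A B A′ B′ P AA BB refl = begin
      (x + x - P) * ((1ℚ + (x + x + 1ℚ + P)) * (c * ((x + x + 1ℚ) * 1ℚ * o)))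
        ≡⟨ solve 4 (λ x c o P → (x :+ x :- P) :* ((con 1ℚ :+ (x :+ x :+ con 1ℚ :+ P)) :* (c :* ((x :+ x :+ con 1ℚ) :* con 1ℚ :* o)))
             := con 1ℚ :* con 1ℚ :* (c :* ((x :+ x :+ con 1ℚ) :* con 1ℚ :* (o :* ((x :+ x :+ con 1ℚ) :* (x :+ x :+ con 1ℚ) :- (con 1ℚ :+ P) :* (con 1ℚ :+ P))))))
             refl x c o P ⟩
      1ℚ * 1ℚ * (c * w)              ≡⟨ cong₂ (λ a b → a * b * (c * w)) AA BB ⟨
      A * A′ * (B * B′) * (c * w)    ≡⟨ solve 6 (λ a a′ b b′ c z → a :* a′ :* (b :* b′) :* (c :* z) := b :* (a :* (c :* (a′ :* b′) :* z))) refl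
                                          A A′ B B′ c w ⟩
      B * (A * (c * (A′ * B′) * w))  ∎
      where
      w : ℚ
      w = (x + x + 1ℚ) * 1ℚ * (o * ((x + x + 1ℚ) * (x + x + 1ℚ) - (1ℚ + P) * (1ℚ + P)))

    step : (Σ ℚ λ c → ∀ k → fromℕ ((2 ℕ.* k ℕ.+ 1 ℕ.+ p) C (2 ℕ.* p ℕ.+ 1)) ≡ c * (h 0 (fromℕ k) * oddProduct p (fromℕ k))) →
           Σ ℚ λ c → ∀ k → fromℕ ((2 ℕ.* k ℕ.+ 1 ℕ.+ suc p) C (2 ℕ.* suc p ℕ.+ 1)) ≡ c * (h 0 (fromℕ k) * oddProduct (suc p) (fromℕ k))
    step (c , E) = c * (recip A * recip B) , λ k → *-cancelˡ A≢0 (*-cancelˡ B≢0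
      (trans (cong₂ (λ n l → B * (A * fromℕ (n C l))) (ℕ.+-suc (2 ℕ.* k ℕ.+ 1) p) (cong (λ l → suc (l ℕ.+ 1)) (ℕ.+-suc p (p ℕ.+ 0))))
      (trans (descend (2 ℕ.* k ℕ.+ 1 ℕ.+ p) (fromℕ k) (trans (fromℕ-+ (2 ℕ.* k ℕ.+ 1) p) (cong (_+ P) (fromℕ-2n+1 k))))
        (regroup (fromℕ k) c (oddProduct p (fromℕ k)) (fromℕ ((2 ℕ.* k ℕ.+ 1 ℕ.+ p) C K)) A B (recip A) (recip B) P
          (recip-inverseʳ A≢0) (recip-inverseʳ B≢0) (E k)))))

  Q-factorisation : ∀ p Q → IsQ p Q → Σ (BPoly p) λ η → ∀ b x →
    eval +-*-rawSemiring id Q (fromℕ b ∷ x ∷ []) ≡ (fromℕ b + x) * ⟦ η ⟧ (fromℕ b) x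
  Q-factorisation p Q isQ = factor (binomial-oddProduct p)
      λ c → subst (λ m → Summable m (λ x → c * (h 0 x * oddProduct p x))) (ℕ.+-identityʳ p) (summable-scale c (summable-h-oddProduct p 0))
    where
    factor : (Σ ℚ λ c → ∀ k → fromℕ ((2 ℕ.* k ℕ.+ 1 ℕ.+ p) C (2 ℕ.* p ℕ.+ 1)) ≡ c * (h 0 (fromℕ k) * oddProduct p (fromℕ k))) →
             (∀ c → Summable p (λ x → c * (h 0 x * oddProduct p x))) →
             Σ (BPoly p) λ η → ∀ b x → eval +-*-rawSemiring id Q (fromℕ b ∷ x ∷ []) ≡ (fromℕ b + x) * ⟦ η ⟧ (fromℕ b) x
    factor (c , C≡) S = quotient (S c) , λ b → isPolyFun-unique (suc b) (isPolyFun-eval Q (fromℕ b))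
      (isPolyFun-cong (λ x → sym (ℚ.*-distribʳ-+ (⟦ η ⟧ (fromℕ b) x) (fromℕ b) x))
        (isPolyFun-+ (isPolyFun-scale (fromℕ b) (isPolyFun-⟦⟧ η (fromℕ b))) (isPolyFun-X* (isPolyFun-⟦⟧ η (fromℕ b)))))
      λ j b<j → *-cancelˡ (W≢0 b j b<j) (begin
        W j b * eval +-*-rawSemiring id Q (fromℕ b ∷ fromℕ j ∷ [])   ≡⟨ cong (_* eval +-*-rawSemiring id Q (fromℕ b ∷ fromℕ j ∷ [])) (W-binomial j b) ⟩
        _                                                            ≡⟨ isQ b j b<j ⟨
        _                                                            ≡⟨ ∑-cong (j ∸ b) (λ i → cong₂ _*_ (C≡ (b ℕ.+ i)) (sym (W-binomial j (b ℕ.+ i)))) ⟩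
        weightedSum (λ x → c * (h 0 x * oddProduct p x)) b j         ≡⟨ sums (S c) b j b<j ⟩
        _                                                            ∎)
      where
      η : BPoly p
      η = quotient (S c)

module _ where
  open import Data.Rational.Base using (_+_; _*_; _-_; -_)

  -- The ring of power series

  interchange : ∀ a b c d → a + b + (c + d) ≡ a + c + (b + d)
  interchange = solve 4 (λ a b c d → a :+ b :+ (c :+ d) := a :+ c :+ (b :+ d)) refl

  antidiagonal : ℕ → (ℕ → ℕ → ℚ) → ℚ
  antidiagonal e φ = ∑ (suc e) λ i → φ i (e ∸ i)

  antidiagonal-cong : ∀ e {φ ψ : ℕ → ℕ → ℚ} → (∀ i j → φ i j ≡ ψ i j) → antidiagonal e φ ≡ antidiagonal e ψ
  antidiagonal-cong e eq = ∑-cong (suc e) λ i → eq i (e ∸ i)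

  antidiagonal-zero : ∀ e {φ : ℕ → ℕ → ℚ} → (∀ i j → φ i j ≡ 0ℚ) → antidiagonal e φ ≡ 0ℚ
  antidiagonal-zero e eq = ∑-zero (suc e) λ i → eq i (e ∸ i)

  antidiagonal-+ : ∀ e (φ ψ : ℕ → ℕ → ℚ) → antidiagonal e (λ i j → φ i j + ψ i j) ≡ antidiagonal e φ + antidiagonal e ψ
  antidiagonal-+ e φ ψ = ∑-+ (suc e) (λ i → φ i (e ∸ i)) (λ i → ψ i (e ∸ i))

  antidiagonal-* : ∀ e q (φ : ℕ → ℕ → ℚ) → antidiagonal e (λ i j → q * φ i j) ≡ q * antidiagonal e φ
  antidiagonal-* e q φ = ∑-* (suc e) q (λ i → φ i (e ∸ i))

  antidiagonal-cong-sum : ∀ e {φ ψ : ℕ → ℕ → ℚ} → (∀ i j → i ℕ.+ j ≡ e → φ i j ≡ ψ i j) → antidiagonal e φ ≡ antidiagonal e ψ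
  antidiagonal-cong-sum zero    eq = cong (_+ 0ℚ) (eq 0 0 refl)
  antidiagonal-cong-sum (suc e) eq = cong₂ _+_ (eq 0 (suc e) refl) (antidiagonal-cong-sum e λ i j i+j≡e → eq (suc i) j (cong suc i+j≡e))

  antidiagonal-sucʳ : ∀ e (φ : ℕ → ℕ → ℚ) → antidiagonal (suc e) φ ≡ antidiagonal e (λ i j → φ i (suc j)) + φ (suc e) 0
  antidiagonal-sucʳ zero    φ = solve 2 (λ a b → a :+ (b :+ con 0ℚ) := a :+ con 0ℚ :+ b) refl (φ 0 1) (φ 1 0)
  antidiagonal-sucʳ (suc e) φ = trans (cong (λ z → φ 0 (suc (suc e)) + z) (antidiagonal-sucʳ e (λ i j → φ (suc i) j)))
    (sym (ℚ.+-assoc (φ 0 (suc (suc e))) (antidiagonal e (λ i j → φ (suc i) (suc j))) (φ (suc (suc e)) 0)))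

  antidiagonal-swap : ∀ e (φ : ℕ → ℕ → ℚ) → antidiagonal e φ ≡ antidiagonal e (λ i j → φ j i)
  antidiagonal-swap zero    φ = refl
  antidiagonal-swap (suc e) φ = trans (antidiagonal-sucʳ e φ) (trans (cong (_+ φ (suc e) 0) (antidiagonal-swap e (λ i j → φ i (suc j))))
    (ℚ.+-comm (antidiagonal e (λ i j → φ j (suc i))) (φ (suc e) 0)))

  antidiagonal-assoc : ∀ e (φ : ℕ → ℕ → ℕ → ℚ) →
    antidiagonal e (λ i j → antidiagonal i (λ k l → φ k l j)) ≡ antidiagonal e (λ i j → antidiagonal j (λ k l → φ i k l))
  antidiagonal-assoc zero    φ = refl
  antidiagonal-assoc (suc e) φ = begin
    φ 0 0 (suc e) + 0ℚ + antidiagonal e (λ i j → φ 0 (suc i) j + antidiagonal i (λ k l → φ (suc k) l j))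
      ≡⟨ cong₂ _+_ (ℚ.+-identityʳ (φ 0 0 (suc e))) (antidiagonal-+ e (λ i j → φ 0 (suc i) j) (λ i j → antidiagonal i (λ k l → φ (suc k) l j))) ⟩
    φ 0 0 (suc e) + (antidiagonal e (λ i j → φ 0 (suc i) j) + antidiagonal e (λ i j → antidiagonal i (λ k l → φ (suc k) l j)))
      ≡⟨ ℚ.+-assoc (φ 0 0 (suc e)) (antidiagonal e (λ i j → φ 0 (suc i) j)) _ ⟨
    antidiagonal (suc e) (φ 0) + antidiagonal e (λ i j → antidiagonal i (λ k l → φ (suc k) l j))
      ≡⟨ cong (λ z → antidiagonal (suc e) (φ 0) + z) (antidiagonal-assoc e (λ i → φ (suc i))) ⟩
    _ ∎
    where open ≡-Reasoning

  convolve-cong : ∀ m {h k : Mon → Mon → ℚ} → (∀ u v → h u v ≡ k u v) → convolve h m ≡ convolve k m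
  convolve-cong []      eq = eq [] []
  convolve-cong (e ∷ m) eq = antidiagonal-cong e λ i j → convolve-cong m λ u v → eq (i ∷ u) (j ∷ v)

  convolve-cong-degree : ∀ m {h k : Mon → Mon → ℚ} → (∀ u v → degree u ℕ.+ degree v ≡ degree m → h u v ≡ k u v) →
                         convolve h m ≡ convolve k m
  convolve-cong-degree []      eq = eq [] [] refl
  convolve-cong-degree (e ∷ m) {h} {k} eq = antidiagonal-cong-sum e λ i j i+j≡e → convolve-cong-degree m λ u v du+dv≡dm →
    eq (i ∷ u) (j ∷ v) (trans (rearrange i (degree u) j (degree v)) (cong₂ ℕ._+_ i+j≡e du+dv≡dm))
    where
    rearrange : ∀ a b c d → a ℕ.+ b ℕ.+ (c ℕ.+ d) ≡ a ℕ.+ c ℕ.+ (b ℕ.+ d)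
    rearrange a b c d = trans (ℕ.+-assoc a b (c ℕ.+ d)) (trans (cong (a ℕ.+_)
      (trans (sym (ℕ.+-assoc b c d)) (trans (cong (ℕ._+ d) (ℕ.+-comm b c)) (ℕ.+-assoc c b d)))) (sym (ℕ.+-assoc a c (b ℕ.+ d))))

  convolve-zero : ∀ m {h : Mon → Mon → ℚ} → (∀ u v → h u v ≡ 0ℚ) → convolve h m ≡ 0ℚ
  convolve-zero []      eq = eq [] []
  convolve-zero (e ∷ m) eq = antidiagonal-zero e λ i j → convolve-zero m λ u v → eq (i ∷ u) (j ∷ v)

  convolve-+ : ∀ m (h k : Mon → Mon → ℚ) → convolve (λ u v → h u v + k u v) m ≡ convolve h m + convolve k m
  convolve-+ []      h k = refl
  convolve-+ (e ∷ m) h k = trans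
    (antidiagonal-cong e λ i j → convolve-+ m (λ u v → h (i ∷ u) (j ∷ v)) (λ u v → k (i ∷ u) (j ∷ v)))
    (antidiagonal-+ e (λ i j → convolve (λ u v → h (i ∷ u) (j ∷ v)) m) (λ i j → convolve (λ u v → k (i ∷ u) (j ∷ v)) m))

  convolve-* : ∀ m q (h : Mon → Mon → ℚ) → convolve (λ u v → q * h u v) m ≡ q * convolve h m
  convolve-* []      q h = refl
  convolve-* (e ∷ m) q h = trans
    (antidiagonal-cong e λ i j → convolve-* m q (λ u v → h (i ∷ u) (j ∷ v)))
    (antidiagonal-* e q (λ i j → convolve (λ u v → h (i ∷ u) (j ∷ v)) m))

  convolve-∑ : ∀ n m (h : ℕ → Mon → Mon → ℚ) → convolve (λ u v → ∑ n (λ i → h i u v)) m ≡ ∑ n (λ i → convolve (h i) m)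
  convolve-∑ zero    m h = convolve-zero m λ _ _ → refl
  convolve-∑ (suc n) m h = trans (convolve-+ m (h 0) (λ u v → ∑ n (λ i → h (suc i) u v)))
    (cong (λ z → convolve (h 0) m + z) (convolve-∑ n m (λ i → h (suc i))))

  convolve-swap : ∀ m (h : Mon → Mon → ℚ) → convolve h m ≡ convolve (λ u v → h v u) m
  convolve-swap []      h = refl
  convolve-swap (e ∷ m) h = trans
    (antidiagonal-swap e (λ i j → convolve (λ u v → h (i ∷ u) (j ∷ v)) m))
    (antidiagonal-cong e λ i j → convolve-swap m (λ u v → h (j ∷ u) (i ∷ v)))

  convolve-assoc : ∀ m (h : Mon → Mon → Mon → ℚ) →
    convolve (λ u w → convolve (λ s t → h s t w) u) m ≡ convolve (λ s w → convolve (λ t u → h s t u) w) m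
  convolve-assoc []      h = refl
  convolve-assoc (e ∷ m) h = begin
    antidiagonal e (λ i j → convolve (λ u w → antidiagonal i (λ k l → convolve (λ s t → h (k ∷ s) (l ∷ t) (j ∷ w)) u)) m)
      ≡⟨ antidiagonal-cong e (λ i j → convolve-∑ (suc i) m (λ k u w → convolve (λ s t → h (k ∷ s) (i ∸ k ∷ t) (j ∷ w)) u)) ⟩
    antidiagonal e (λ i j → antidiagonal i (λ k l → convolve (λ u w → convolve (λ s t → h (k ∷ s) (l ∷ t) (j ∷ w)) u) m))
      ≡⟨ antidiagonal-assoc e (λ k l j → convolve (λ u w → convolve (λ s t → h (k ∷ s) (l ∷ t) (j ∷ w)) u) m) ⟩
    antidiagonal e (λ i j → antidiagonal j (λ k l → convolve (λ u w → convolve (λ s t → h (i ∷ s) (k ∷ t) (l ∷ w)) u) m))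
      ≡⟨ antidiagonal-cong e (λ i j → antidiagonal-cong j λ k l → convolve-assoc m (λ s t u → h (i ∷ s) (k ∷ t) (l ∷ u))) ⟩
    antidiagonal e (λ i j → antidiagonal j (λ k l → convolve (λ s w → convolve (λ t u → h (i ∷ s) (k ∷ t) (l ∷ u)) w) m))
      ≡⟨ antidiagonal-cong e (λ i j → convolve-∑ (suc j) m (λ k s w → convolve (λ t u → h (i ∷ s) (k ∷ t) (j ∸ k ∷ u)) w)) ⟨
    _ ∎
    where open ≡-Reasoning

  -- Wrapping _≈_ in a record lets Agda infer the two series from the type.
  infix 4 _≋_
  record _≋_ (F G : PS) : Set where
    constructor ⟪_⟫
    field coeffs : F ≈ G
  open _≋_ public


  negₛ : PS → PS
  negₛ F = mapS (-_) F

  constCoeff-* : ∀ p q m → constCoeff 0ℚ (p * q) m ≡ p * constCoeff 0ℚ q m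
  constCoeff-* p q []          = refl
  constCoeff-* p q (zero  ∷ m) = constCoeff-* p q m
  constCoeff-* p q (suc _ ∷ m) = sym (ℚ.*-zeroʳ p)

  constCoeff-0 : ∀ m → constCoeff 0ℚ 0ℚ m ≡ 0ℚ
  constCoeff-0 []          = refl
  constCoeff-0 (zero  ∷ m) = constCoeff-0 m
  constCoeff-0 (suc _ ∷ m) = refl

  convolve-const : ∀ q (F : Mon → ℚ) m → convolve (λ u v → constCoeff 0ℚ q u * F v) m ≡ q * F m
  convolve-const q F []      = refl
  convolve-const q F (e ∷ m) = trans
    (cong₂ _+_ (convolve-const q (λ v → F (e ∷ v)) m)
      (∑-zero e λ i → convolve-zero m λ u v → ℚ.*-zeroˡ (F (e ∸ suc i ∷ v))))
    (ℚ.+-identityʳ (q * F (e ∷ m)))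

  ratS-* : ∀ q F → ratS q *ₛ F ≋ q ·ₛ F
  ratS-* q F = ⟪ convolve-const q (coeff F) ⟫

  *ₛ-comm : ∀ F G → F *ₛ G ≋ G *ₛ F
  *ₛ-comm F G = ⟪ (λ m → trans (convolve-swap m (λ u v → coeff F u * coeff G v))
    (convolve-cong m λ u v → ℚ.*-comm (coeff F v) (coeff G u))) ⟫

  *ₛ-cong : ∀ {F F′ G G′} → F ≋ F′ → G ≋ G′ → F *ₛ G ≋ F′ *ₛ G′
  *ₛ-cong ⟪ p ⟫ ⟪ q ⟫ = ⟪ (λ m → convolve-cong m λ u v → cong₂ _*_ (p u) (q v)) ⟫

  *ₛ-assoc : ∀ F G H → F *ₛ G *ₛ H ≋ F *ₛ (G *ₛ H)
  *ₛ-assoc F G H = ⟪ (λ m → begin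
    convolve (λ u w → convolve (λ s t → coeff F s * coeff G t) u * coeff H w) m
      ≡⟨ convolve-cong m (λ u w → trans (ℚ.*-comm _ (coeff H w)) (sym (convolve-* u (coeff H w) (λ s t → coeff F s * coeff G t)))) ⟩
    convolve (λ u w → convolve (λ s t → coeff H w * (coeff F s * coeff G t)) u) m
      ≡⟨ convolve-assoc m (λ s t w → coeff H w * (coeff F s * coeff G t)) ⟩
    convolve (λ s w → convolve (λ t u → coeff H u * (coeff F s * coeff G t)) w) m
      ≡⟨ convolve-cong m (λ s w → trans (convolve-cong w λ t u → rotate (coeff H u) (coeff F s) (coeff G t)) (convolve-* w (coeff F s) (λ t u → coeff G t * coeff H u))) ⟩
    convolve (λ s w → coeff F s * convolve (λ t u → coeff G t * coeff H u) w) m ∎) ⟫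
    where
    open ≡-Reasoning
    rotate : ∀ h f g → h * (f * g) ≡ f * (g * h)
    rotate = solve 3 (λ h f g → h :* (f :* g) := f :* (g :* h)) refl

  *ₛ-identityˡ : ∀ F → 1ₛ *ₛ F ≋ F
  *ₛ-identityˡ F = ⟪ (λ m → trans (convolve-const 1ℚ (coeff F) m) (ℚ.*-identityˡ (coeff F m))) ⟫

  *ₛ-distribˡ : ∀ F G H → F *ₛ (G +ₛ H) ≋ F *ₛ G +ₛ F *ₛ H
  *ₛ-distribˡ F G H = ⟪ (λ m → trans (convolve-cong m λ u v → ℚ.*-distribˡ-+ (coeff F u) (coeff G v) (coeff H v))
    (convolve-+ m (λ u v → coeff F u * coeff G v) (λ u v → coeff F u * coeff H v))) ⟫

  ≋-refl : ∀ {F} → F ≋ F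
  ≋-refl = ⟪ (λ _ → refl) ⟫

  ≋-sym : ∀ {F G} → F ≋ G → G ≋ F
  ≋-sym ⟪ p ⟫ = ⟪ (λ m → sym (p m)) ⟫

  ≋-trans : ∀ {F G H} → F ≋ G → G ≋ H → F ≋ H
  ≋-trans ⟪ p ⟫ ⟪ q ⟫ = ⟪ (λ m → trans (p m) (q m)) ⟫

  +ₛ-cong : ∀ {F F′ G G′} → F ≋ F′ → G ≋ G′ → F +ₛ G ≋ F′ +ₛ G′
  +ₛ-cong ⟪ p ⟫ ⟪ q ⟫ = ⟪ (λ m → cong₂ _+_ (p m) (q m)) ⟫

  PS-commutativeRing : CommutativeRing 0ℓ 0ℓ
  PS-commutativeRing = record
    { Carrier = PS ; _≈_ = _≋_ ; _+_ = _+ₛ_ ; _*_ = _*ₛ_ ; -_ = negₛ ; 0# = 0ₛ ; 1# = 1ₛ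
    ; isCommutativeRing = record
      { isRing = record
        { +-isAbelianGroup = record
          { isGroup = record
            { isMonoid = record
              { isSemigroup = record
                { isMagma = record { isEquivalence = record { refl = ≋-refl ; sym = ≋-sym ; trans = ≋-trans } ; ∙-cong = +ₛ-cong }
                ; assoc = λ F G H → ⟪ (λ m → ℚ.+-assoc (coeff F m) (coeff G m) (coeff H m)) ⟫ }
              ; identity = (λ F → ⟪ (λ m → trans (cong (_+ coeff F m) (constCoeff-0 m)) (ℚ.+-identityˡ (coeff F m))) ⟫)
                         , (λ F → ⟪ (λ m → trans (cong (λ z → coeff F m + z) (constCoeff-0 m)) (ℚ.+-identityʳ (coeff F m))) ⟫) }
            ; inverse = (λ F → ⟪ (λ m → trans (ℚ.+-inverseˡ (coeff F m)) (sym (constCoeff-0 m))) ⟫)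
                      , (λ F → ⟪ (λ m → trans (ℚ.+-inverseʳ (coeff F m)) (sym (constCoeff-0 m))) ⟫)
            ; ⁻¹-cong = λ { ⟪ p ⟫ → ⟪ (λ m → cong -_ (p m)) ⟫ } }
          ; comm = λ F G → ⟪ (λ m → ℚ.+-comm (coeff F m) (coeff G m)) ⟫ }
        ; *-cong = *ₛ-cong
        ; *-assoc = *ₛ-assoc
        ; *-identity = *ₛ-identityˡ , λ F → ≋-trans (*ₛ-comm F 1ₛ) (*ₛ-identityˡ F)
        ; distrib = *ₛ-distribˡ , λ F G H → ≋-trans (*ₛ-comm (G +ₛ H) F)
            (≋-trans (*ₛ-distribˡ F G H) (+ₛ-cong (*ₛ-comm F G) (*ₛ-comm F H))) }
      ; *-comm = *ₛ-comm } }

  module PSR = CommutativeRing PS-commutativeRing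
  open SetoidReasoning PSR.setoid

  ·ₛ-cong : ∀ q {F G} → F ≋ G → q ·ₛ F ≋ q ·ₛ G
  ·ₛ-cong q ⟪ p ⟫ = ⟪ (λ m → cong (q *_) (p m)) ⟫

  *ₛ-·ₛ : ∀ q F G → F *ₛ (q ·ₛ G) ≋ q ·ₛ (F *ₛ G)
  *ₛ-·ₛ q F G = ⟪ (λ m → trans (convolve-cong m λ u v → solve 3 (λ f q g → f :* (q :* g) := q :* (f :* g)) refl (coeff F u) q (coeff G v))
    (convolve-* m q (λ u v → coeff F u * coeff G v))) ⟫

  ^ₛ-+ : ∀ F m n → F ^ₛ (m ℕ.+ n) ≋ F ^ₛ m *ₛ F ^ₛ n
  ^ₛ-+ F zero    n = ≋-sym (*ₛ-identityˡ (F ^ₛ n))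
  ^ₛ-+ F (suc m) n = ≋-trans (PSR.*-congˡ (^ₛ-+ F m n)) (≋-sym (*ₛ-assoc F (F ^ₛ m) (F ^ₛ n)))

  -- Derivation

  slice : ℕ → PS → PS
  slice e F .coeff m  = coeff F (e ∷ m)
  slice e F .padded m = padded F (e ∷ m)

  ≋-slices : ∀ {F G} → (∀ e m → coeff F (e ∷ m) ≡ coeff G (e ∷ m)) → F ≋ G
  ≋-slices {F} {G} eq = ⟪ (λ { [] → trans (sym (padded F [])) (trans (eq 0 []) (padded G [])) ; (e ∷ m) → eq e m }) ⟫

  ∂-cong : ∀ {F G} → F ≋ G → ∂ F ≋ ∂ G
  ∂-cong ⟪ p ⟫ = ≋-slices λ e m → cong (fromℕ (suc e) *_) (p (suc e ∷ m))

  ∂-+ : ∀ F G → ∂ (F +ₛ G) ≋ ∂ F +ₛ ∂ G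
  ∂-+ F G = ≋-slices λ e m → ℚ.*-distribˡ-+ (fromℕ (suc e)) (coeff F (suc e ∷ m)) (coeff G (suc e ∷ m))

  ∂-·ₛ : ∀ q F → ∂ (q ·ₛ F) ≋ q ·ₛ ∂ F
  ∂-·ₛ q F = ≋-slices λ e m → solve 3 (λ a q b → a :* (q :* b) := q :* (a :* b)) refl (fromℕ (suc e)) q (coeff F (suc e ∷ m))

  ∂-ratS : ∀ q → ∂ (ratS q) ≋ 0ₛ
  ∂-ratS q = ≋-slices λ { zero m → trans (ℚ.*-zeroʳ (fromℕ 1)) (sym (constCoeff-0 m)) ; (suc e) m → ℚ.*-zeroʳ (fromℕ (suc (suc e))) }

  antidiagonal-weighted : ∀ e (φ : ℕ → ℕ → ℚ) → fromℕ e * antidiagonal e φ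
    ≡ antidiagonal e (λ i j → fromℕ i * φ i j) + antidiagonal e (λ i j → fromℕ j * φ i j)
  antidiagonal-weighted e φ = trans (sym (antidiagonal-* e (fromℕ e) φ)) (trans
    (antidiagonal-cong-sum e λ i j i+j≡e → trans (cong (λ n → fromℕ n * φ i j) (sym i+j≡e))
      (trans (cong (_* φ i j) (fromℕ-+ i j)) (ℚ.*-distribʳ-+ (φ i j) (fromℕ i) (fromℕ j))))
    (antidiagonal-+ e (λ i j → fromℕ i * φ i j) (λ i j → fromℕ j * φ i j)))

  antidiagonal-derivative : ∀ e (φ : ℕ → ℕ → ℚ) → fromℕ (suc e) * antidiagonal (suc e) φ
    ≡ antidiagonal e (λ i j → fromℕ (suc i) * φ (suc i) j) + antidiagonal e (λ i j → fromℕ (suc j) * φ i (suc j))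
  antidiagonal-derivative e φ = trans (antidiagonal-weighted (suc e) φ) (cong₂ _+_
    (trans (cong (_+ left) (ℚ.*-zeroˡ (φ 0 (suc e)))) (ℚ.+-identityˡ left))
    (trans (antidiagonal-sucʳ e (λ i j → fromℕ j * φ i j))
      (trans (cong (λ z → right + z) (ℚ.*-zeroˡ (φ (suc e) 0))) (ℚ.+-identityʳ right))))
    where
    left right : ℚ
    left  = antidiagonal e (λ i j → fromℕ (suc i) * φ (suc i) j)
    right = antidiagonal e (λ i j → fromℕ (suc j) * φ i (suc j))

  ∂-* : ∀ F G → ∂ (F *ₛ G) ≋ ∂ F *ₛ G +ₛ F *ₛ ∂ G
  ∂-* F G = ≋-slices λ e m → trans
    (antidiagonal-derivative e (λ i j → convolve (λ u v → coeff F (i ∷ u) * coeff G (j ∷ v)) m))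
    (cong₂ _+_
      (antidiagonal-cong e λ i j → trans (sym (convolve-* m (fromℕ (suc i)) (λ u v → coeff F (suc i ∷ u) * coeff G (j ∷ v))))
        (convolve-cong m λ u v → sym (ℚ.*-assoc (fromℕ (suc i)) (coeff F (suc i ∷ u)) (coeff G (j ∷ v)))))
      (antidiagonal-cong e λ i j → trans (sym (convolve-* m (fromℕ (suc j)) (λ u v → coeff F (i ∷ u) * coeff G (suc j ∷ v))))
        (convolve-cong m λ u v → swap (fromℕ (suc j)) (coeff F (i ∷ u)) (coeff G (suc j ∷ v)))))
    where
    swap : ∀ a b c → a * (b * c) ≡ b * (a * c)
    swap = solve 3 (λ a b c → a :* (b :* c) := b :* (a :* c)) refl

  ∂-y₀ : ∂ y₀ ≋ 1ₛ
  ∂-y₀ = ≋-slices λ { zero m → ℚ.*-identityˡ (constCoeff 0ℚ 1ℚ m) ; (suc e) m → ℚ.*-zeroʳ (fromℕ (suc (suc e))) }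

  -- Inverses

  coeff-degree-0 : ∀ F m → degree m ≡ 0 → coeff F m ≡ constantTerm F
  coeff-degree-0 F []         _  = refl
  coeff-degree-0 F (zero ∷ m) eq = trans (coeff-degree-0 (slice 0 F) m eq) (padded F [])

  ^ₛ-order : ∀ F → constantTerm F ≡ 0ℚ → ∀ n m → degree m < n → coeff (F ^ₛ n) m ≡ 0ℚ
  ^ₛ-order F F₀≡0 (suc n) m m<1+n = trans (convolve-cong-degree m term) (convolve-zero m λ _ _ → refl)
    where
    term : ∀ u v → degree u ℕ.+ degree v ≡ degree m → coeff F u * coeff (F ^ₛ n) v ≡ 0ℚ
    term u v eq = go (degree u) refl
      where
      go : ∀ d → degree u ≡ d → coeff F u * coeff (F ^ₛ n) v ≡ 0ℚ
      go zero    du = trans (cong (_* coeff (F ^ₛ n) v) (trans (coeff-degree-0 F u du) F₀≡0)) (ℚ.*-zeroˡ (coeff (F ^ₛ n) v))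
      go (suc d) du = trans (cong (coeff F u *_) (^ₛ-order F F₀≡0 n v
        (ℕ.≤-trans (s≤s (ℕ.m≤n+m (degree v) d)) (ℕ.≤-trans (ℕ.≤-reflexive (trans (cong (ℕ._+ degree v) (sym du)) eq)) (ℕ.≤-pred m<1+n)))))
        (ℚ.*-zeroʳ (coeff F u))

  powerSum : PS → ℕ → PS
  powerSum G zero    = 1ₛ
  powerSum G (suc N) = powerSum G N +ₛ G ^ₛ suc N

  coeff-powerSum : ∀ G N m → coeff (powerSum G N) m ≡ ∑ (suc N) (λ n → coeff (G ^ₛ n) m)
  coeff-powerSum G zero    m = sym (ℚ.+-identityʳ (coeff 1ₛ m))
  coeff-powerSum G (suc N) m = trans (cong (_+ coeff (G ^ₛ suc N) m) (coeff-powerSum G N m)) (sym (∑-suc (suc N) (λ n → coeff (G ^ₛ n) m)))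

  coeff-powerSum-stable : ∀ G → constantTerm G ≡ 0ℚ → ∀ {d N} m → d ℕ.≤′ N → degree m ≡ d →
                          coeff (powerSum G N) m ≡ coeff (powerSum G d) m
  coeff-powerSum-stable G G₀ m ℕ.≤′-refl       eq = refl
  coeff-powerSum-stable G G₀ m (ℕ.≤′-step {N} d≤N) eq = trans
    (cong₂ _+_ (coeff-powerSum-stable G G₀ m d≤N eq)
      (^ₛ-order G G₀ (suc N) m (s≤s (ℕ.≤-trans (ℕ.≤-reflexive eq) (ℕ.≤′⇒≤ d≤N)))))
    (ℚ.+-identityʳ _)

  powerSum-shift : ∀ G N → 1ₛ +ₛ G *ₛ powerSum G N ≋ powerSum G N +ₛ G ^ₛ suc N
  powerSum-shift G zero    = ≋-refl
  powerSum-shift G (suc N) = begin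
    1ₛ +ₛ G *ₛ (powerSum G N +ₛ G ^ₛ suc N)               ≈⟨ PSR.+-congˡ (*ₛ-distribˡ G (powerSum G N) (G ^ₛ suc N)) ⟩
    1ₛ +ₛ (G *ₛ powerSum G N +ₛ G *ₛ G ^ₛ suc N)          ≈⟨ PSR.+-assoc 1ₛ (G *ₛ powerSum G N) (G *ₛ G ^ₛ suc N) ⟨
    1ₛ +ₛ G *ₛ powerSum G N +ₛ G *ₛ G ^ₛ suc N            ≈⟨ PSR.+-congʳ (powerSum-shift G N) ⟩
    powerSum G N +ₛ G ^ₛ suc N +ₛ G *ₛ G ^ₛ suc N         ∎

  inv-inverseʳ : ∀ F → constantTerm F ≢ 0ℚ → F *ₛ inv F ≋ 1ₛ
  inv-inverseʳ F F₀≢0 = ⟪ at ⟫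
    where
    c⁻¹ : ℚ
    c⁻¹ = recip (constantTerm F)
    G : PS
    G = 1ₛ -ₛ c⁻¹ ·ₛ F
    G₀≡0 : constantTerm G ≡ 0ℚ
    G₀≡0 = trans (cong (λ z → 1ℚ - z) (trans (ℚ.*-comm c⁻¹ (constantTerm F)) (recip-inverseʳ F₀≢0))) refl

    geometric : ∀ N → c⁻¹ ·ₛ (F *ₛ powerSum G N) +ₛ G ^ₛ suc N ≋ 1ₛ
    geometric N = begin
      H +ₛ G ^ₛ suc N                                           ≈⟨ ⟪ (λ m → cancel (coeff H m) (coeff (G ^ₛ suc N) m) (coeff (powerSum G N) m)) ⟫ ⟩
      (H +ₛ (powerSum G N +ₛ G ^ₛ suc N)) -ₛ powerSum G N      ≈⟨ minus (PSR.+-congˡ (≋-sym (powerSum-shift G N))) ⟩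
      (H +ₛ (1ₛ +ₛ G *ₛ powerSum G N)) -ₛ powerSum G N         ≈⟨ minus swap ⟩
      (1ₛ +ₛ (c⁻¹ ·ₛ F +ₛ G) *ₛ powerSum G N) -ₛ powerSum G N  ≈⟨ minus (PSR.+-congˡ (PSR.*-congʳ complement)) ⟩
      (1ₛ +ₛ 1ₛ *ₛ powerSum G N) -ₛ powerSum G N               ≈⟨ minus (PSR.+-congˡ (*ₛ-identityˡ (powerSum G N))) ⟩
      (1ₛ +ₛ powerSum G N) -ₛ powerSum G N                     ≈⟨ ⟪ (λ m → solve 2 (λ a b → a :+ b :- b := a) refl (coeff 1ₛ m) (coeff (powerSum G N) m)) ⟫ ⟩
      1ₛ                                                       ∎
      where
      H : PS
      H = c⁻¹ ·ₛ (F *ₛ powerSum G N)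
      cancel : ∀ a b c → a + b ≡ a + (c + b) - c
      cancel = solve 3 (λ a b c → a :+ b := a :+ (c :+ b) :- c) refl
      minus : ∀ {A B C} → A ≋ B → A -ₛ C ≋ B -ₛ C
      minus {C = C} ⟪ p ⟫ = ⟪ (λ m → cong (_- coeff C m) (p m)) ⟫
      complement : c⁻¹ ·ₛ F +ₛ G ≋ 1ₛ
      complement = ⟪ (λ m → solve 2 (λ a b → a :+ (b :- a) := b) refl (c⁻¹ * coeff F m) (coeff 1ₛ m)) ⟫
      swap : H +ₛ (1ₛ +ₛ G *ₛ powerSum G N) ≋ 1ₛ +ₛ (c⁻¹ ·ₛ F +ₛ G) *ₛ powerSum G N
      swap = begin
        H +ₛ (1ₛ +ₛ G *ₛ powerSum G N)                              ≈⟨ ⟪ (λ m → solve 3 (λ a b c → a :+ (b :+ c) := b :+ (a :+ c)) refl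
                                                                         (coeff H m) (coeff 1ₛ m) (coeff (G *ₛ powerSum G N) m)) ⟫ ⟩
        1ₛ +ₛ (H +ₛ G *ₛ powerSum G N)                              ≈⟨ PSR.+-congˡ (PSR.+-congʳ (≋-trans (·ₛ-cong c⁻¹ (*ₛ-comm F (powerSum G N)))
                                                                         (≋-trans (≋-sym (*ₛ-·ₛ c⁻¹ (powerSum G N) F)) (*ₛ-comm (powerSum G N) (c⁻¹ ·ₛ F))))) ⟩
        1ₛ +ₛ (c⁻¹ ·ₛ F *ₛ powerSum G N +ₛ G *ₛ powerSum G N)       ≈⟨ PSR.+-congˡ (PSR.distribʳ (powerSum G N) (c⁻¹ ·ₛ F) G) ⟨
        1ₛ +ₛ (c⁻¹ ·ₛ F +ₛ G) *ₛ powerSum G N                       ∎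

    at : F *ₛ inv F ≈ 1ₛ
    at m = ≡.begin
      convolve (λ u v → coeff F u * coeff (inv F) v) m                       ≡.≡⟨ convolve-cong-degree m truncate ⟩
      convolve (λ u v → c⁻¹ * (coeff F u * coeff (powerSum G N) v)) m        ≡.≡⟨ convolve-* m c⁻¹ (λ u v → coeff F u * coeff (powerSum G N) v) ⟩
      c⁻¹ * coeff (F *ₛ powerSum G N) m                                      ≡.≡⟨ ℚ.+-identityʳ _ ⟨
      c⁻¹ * coeff (F *ₛ powerSum G N) m + 0ℚ                                 ≡.≡⟨ cong (λ z → c⁻¹ * coeff (F *ₛ powerSum G N) m + z) (^ₛ-order G G₀≡0 (suc N) m ℕ.≤-refl) ⟨
      c⁻¹ * coeff (F *ₛ powerSum G N) m + coeff (G ^ₛ suc N) m               ≡.≡⟨ coeffs (geometric N) m ⟩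
      coeff 1ₛ m                                                             ≡.∎
      where
      module ≡ = ≡-Reasoning
      N : ℕ
      N = degree m
      truncate : ∀ u v → degree u ℕ.+ degree v ≡ N → coeff F u * coeff (inv F) v ≡ c⁻¹ * (coeff F u * coeff (powerSum G N) v)
      truncate u v eq = trans
        (cong (λ z → coeff F u * (c⁻¹ * z)) (trans (sym (coeff-powerSum G (degree v) v))
          (sym (coeff-powerSum-stable G G₀≡0 v (ℕ.≤⇒≤′ (ℕ.≤-trans (ℕ.m≤n+m (degree v) (degree u)) (ℕ.≤-reflexive eq))) refl))))
        (solve 3 (λ f c z → f :* (c :* z) := c :* (f :* z)) refl (coeff F u) c⁻¹ (coeff (powerSum G N) v))

  -- Integer powers and substitution for r

  ·ₛ-*ₛ : ∀ q F G → (q ·ₛ F) *ₛ G ≋ q ·ₛ (F *ₛ G)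
  ·ₛ-*ₛ q F G = ≋-trans (*ₛ-comm (q ·ₛ F) G) (≋-trans (*ₛ-·ₛ q G F) (·ₛ-cong q (*ₛ-comm G F)))

  ·ₛ-congˡ : ∀ {p q} F → p ≡ q → p ·ₛ F ≋ q ·ₛ F
  ·ₛ-congˡ F refl = ≋-refl

  x∙yz≋y∙xz : ∀ F G H → F *ₛ (G *ₛ H) ≋ G *ₛ (F *ₛ H)
  x∙yz≋y∙xz F G H = ≋-trans (≋-sym (*ₛ-assoc F G H)) (≋-trans (PSR.*-congʳ (*ₛ-comm F G)) (*ₛ-assoc G F H))

  ℤ-induction : ∀ (P : ℤ → Set) → P (+ 0) → (∀ k → P k → P (ℤ.suc k)) → (∀ k → P (ℤ.suc k) → P k) → ∀ k → P k
  ℤ-induction P P0 up down (+ zero)        = P0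
  ℤ-induction P P0 up down (+ suc n)       = up (+ n) (ℤ-induction P P0 up down (+ n))
  ℤ-induction P P0 up down -[1+ zero ]     = down -[1+ 0 ] P0
  ℤ-induction P P0 up down -[1+ suc n ]    = down -[1+ suc n ] (ℤ-induction P P0 up down -[1+ n ])

  module IntegerPowers (R : PS) (R*invR≋1 : R *ₛ inv R ≋ 1ₛ) where

    R*-cancelˡ : ∀ {F G} → R *ₛ F ≋ R *ₛ G → F ≋ G
    R*-cancelˡ {F} {G} eq = ≋-trans (≋-sym (lemma F)) (≋-trans (PSR.*-congˡ eq) (lemma G))
      where
      lemma : ∀ F → inv R *ₛ (R *ₛ F) ≋ F
      lemma F = begin
        inv R *ₛ (R *ₛ F)   ≈⟨ *ₛ-assoc (inv R) R F ⟨
        inv R *ₛ R *ₛ F     ≈⟨ PSR.*-congʳ (≋-trans (*ₛ-comm (inv R) R) R*invR≋1) ⟩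
        1ₛ *ₛ F             ≈⟨ *ₛ-identityˡ F ⟩
        F                   ∎

    ^ᶻ-suc : ∀ k → R ^ᶻ (ℤ.suc k) ≋ R *ₛ R ^ᶻ k
    ^ᶻ-suc (+ n)          = ≋-refl
    ^ᶻ-suc -[1+ zero ]    = ≋-sym (≋-trans (PSR.*-congˡ (PSR.*-identityʳ (inv R))) R*invR≋1)
    ^ᶻ-suc -[1+ suc n ]   = ≋-sym (begin
      R *ₛ (inv R *ₛ inv R ^ₛ suc n)     ≈⟨ *ₛ-assoc R (inv R) (inv R ^ₛ suc n) ⟨
      R *ₛ inv R *ₛ inv R ^ₛ suc n       ≈⟨ PSR.*-congʳ R*invR≋1 ⟩
      1ₛ *ₛ inv R ^ₛ suc n               ≈⟨ *ₛ-identityˡ (inv R ^ₛ suc n) ⟩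
      inv R ^ₛ suc n                     ∎)

    ^ᶻ-+ : ∀ l k → R ^ᶻ (l ℤ.+ k) ≋ R ^ᶻ l *ₛ R ^ᶻ k
    ^ᶻ-+ l k = ℤ-induction (λ l → R ^ᶻ (l ℤ.+ k) ≋ R ^ᶻ l *ₛ R ^ᶻ k)
      (≋-trans (PSR.reflexive (cong (R ^ᶻ_) (ℤ.+-identityˡ k))) (≋-sym (*ₛ-identityˡ (R ^ᶻ k))))
      (λ l eq → ≋-trans (left l) (≋-trans (PSR.*-congˡ eq) (≋-sym (right l))))
      (λ l eq → R*-cancelˡ (≋-trans (≋-sym (left l)) (≋-trans eq (right l))))
      l
      where
      left : ∀ l → R ^ᶻ (ℤ.suc l ℤ.+ k) ≋ R *ₛ R ^ᶻ (l ℤ.+ k)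
      left l = ≋-trans (PSR.reflexive (cong (R ^ᶻ_) (ℤ.+-assoc (+ 1) l k))) (^ᶻ-suc (l ℤ.+ k))
      right : ∀ l → R ^ᶻ (ℤ.suc l) *ₛ R ^ᶻ k ≋ R *ₛ (R ^ᶻ l *ₛ R ^ᶻ k)
      right l = ≋-trans (PSR.*-congʳ (^ᶻ-suc l)) (*ₛ-assoc R (R ^ᶻ l) (R ^ᶻ k))

    ∂-^ᶻ : ∀ k → R *ₛ ∂ (R ^ᶻ k) ≋ fromℤ k ·ₛ (R ^ᶻ k *ₛ ∂ R)
    ∂-^ᶻ = ℤ-induction (λ k → R *ₛ ∂ (R ^ᶻ k) ≋ fromℤ k ·ₛ (R ^ᶻ k *ₛ ∂ R))
      (≋-trans (PSR.*-congˡ (∂-ratS 1ℚ)) (≋-trans (PSR.zeroʳ R) (≋-trans (≋-sym (PSR.zeroˡ (1ₛ *ₛ ∂ R))) (ratS-* 0ℚ (1ₛ *ₛ ∂ R)))))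
      (λ k eq → ≋-trans (left k) (≋-trans (PSR.+-congˡ (PSR.*-congˡ eq)) (≋-sym (right k))))
      (λ k eq → R*-cancelˡ (∙-cancelˡ (R *ₛ (R ^ᶻ k *ₛ ∂ R)) _ _ (≋-trans (≋-sym (left k)) (≋-trans eq (right k)))))
      where
      open AbelianGroupProperties PSR.+-abelianGroup using (∙-cancelˡ)
      left : ∀ k → R *ₛ ∂ (R ^ᶻ (ℤ.suc k)) ≋ R *ₛ (R ^ᶻ k *ₛ ∂ R) +ₛ R *ₛ (R *ₛ ∂ (R ^ᶻ k))
      left k = begin
        R *ₛ ∂ (R ^ᶻ (ℤ.suc k))                                  ≈⟨ PSR.*-congˡ (∂-cong (^ᶻ-suc k)) ⟩
        R *ₛ ∂ (R *ₛ R ^ᶻ k)                                     ≈⟨ PSR.*-congˡ (∂-* R (R ^ᶻ k)) ⟩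
        R *ₛ (∂ R *ₛ R ^ᶻ k +ₛ R *ₛ ∂ (R ^ᶻ k))                  ≈⟨ PSR.distribˡ R _ _ ⟩
        R *ₛ (∂ R *ₛ R ^ᶻ k) +ₛ R *ₛ (R *ₛ ∂ (R ^ᶻ k))           ≈⟨ PSR.+-congʳ (PSR.*-congˡ (*ₛ-comm (∂ R) (R ^ᶻ k))) ⟩
        R *ₛ (R ^ᶻ k *ₛ ∂ R) +ₛ R *ₛ (R *ₛ ∂ (R ^ᶻ k))           ∎
      right : ∀ k → fromℤ (ℤ.suc k) ·ₛ (R ^ᶻ (ℤ.suc k) *ₛ ∂ R) ≋ R *ₛ (R ^ᶻ k *ₛ ∂ R) +ₛ R *ₛ (fromℤ k ·ₛ (R ^ᶻ k *ₛ ∂ R))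
      right k = begin
        fromℤ (ℤ.suc k) ·ₛ (R ^ᶻ (ℤ.suc k) *ₛ ∂ R)               ≈⟨ ·ₛ-congˡ (R ^ᶻ (ℤ.suc k) *ₛ ∂ R) (fromℤ-+ (+ 1) k) ⟩
        (1ℚ + fromℤ k) ·ₛ (R ^ᶻ (ℤ.suc k) *ₛ ∂ R)                ≈⟨ ·ₛ-cong (1ℚ + fromℤ k) (≋-trans (PSR.*-congʳ (^ᶻ-suc k)) (*ₛ-assoc R (R ^ᶻ k) (∂ R))) ⟩
        (1ℚ + fromℤ k) ·ₛ (R *ₛ (R ^ᶻ k *ₛ ∂ R))                 ≈⟨ ⟪ (λ m → split (fromℤ k) (coeff (R *ₛ (R ^ᶻ k *ₛ ∂ R)) m)) ⟫ ⟩
        R *ₛ (R ^ᶻ k *ₛ ∂ R) +ₛ fromℤ k ·ₛ (R *ₛ (R ^ᶻ k *ₛ ∂ R)) ≈⟨ PSR.+-congˡ (*ₛ-·ₛ (fromℤ k) R (R ^ᶻ k *ₛ ∂ R)) ⟨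
        R *ₛ (R ^ᶻ k *ₛ ∂ R) +ₛ R *ₛ (fromℤ k ·ₛ (R ^ᶻ k *ₛ ∂ R)) ∎
        where
        split : ∀ q x → (1ℚ + q) * x ≡ x + q * x
        split = solve 2 (λ q x → (con 1ℚ :+ q) :* x := x :+ q :* x) refl

  -- The linear functional r^k ↦ ψ k on Laurent polynomials.
  pairing : (ℤ → ℚ) → Laurent → ℚ
  pairing ψ []            = 0ℚ
  pairing ψ ((a , k) ∷ L) = a * ψ k + pairing ψ L

  pairing-cong : ∀ {φ ψ} L → (∀ k → φ k ≡ ψ k) → pairing φ L ≡ pairing ψ L
  pairing-cong []            eq = refl
  pairing-cong ((a , k) ∷ L) eq = cong₂ (λ x y → a * x + y) (eq k) (pairing-cong L eq)

  pairing-zero : ∀ L → pairing (λ _ → 0ℚ) L ≡ 0ℚ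
  pairing-zero []            = refl
  pairing-zero ((a , k) ∷ L) = cong₂ _+_ (ℚ.*-zeroʳ a) (pairing-zero L)

  pairing-+ : ∀ φ ψ L → pairing (λ k → φ k + ψ k) L ≡ pairing φ L + pairing ψ L
  pairing-+ φ ψ []            = refl
  pairing-+ φ ψ ((a , k) ∷ L) = trans (cong₂ _+_ (ℚ.*-distribˡ-+ a (φ k) (ψ k)) (pairing-+ φ ψ L))
    (interchange (a * φ k) (a * ψ k) (pairing φ L) (pairing ψ L))

  pairing-* : ∀ q ψ L → pairing (λ k → q * ψ k) L ≡ q * pairing ψ L
  pairing-* q ψ []            = sym (ℚ.*-zeroʳ q)
  pairing-* q ψ ((a , k) ∷ L) = trans (cong (λ z → a * (q * ψ k) + z) (pairing-* q ψ L))
    (solve 4 (λ a q x y → a :* (q :* x) :+ q :* y := q :* (a :* x :+ y)) refl a q (ψ k) (pairing ψ L))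

  pairing-++ : ∀ ψ L L′ → pairing ψ (L ++ L′) ≡ pairing ψ L + pairing ψ L′
  pairing-++ ψ []            L′ = sym (ℚ.+-identityˡ (pairing ψ L′))
  pairing-++ ψ ((a , k) ∷ L) L′ = trans (cong (λ z → a * ψ k + z) (pairing-++ ψ L L′)) (sym (ℚ.+-assoc (a * ψ k) (pairing ψ L) (pairing ψ L′)))

  pairing-convolve : ∀ (h : ℤ → Mon → Mon → ℚ) m L →
    pairing (λ k → convolve (h k) m) L ≡ convolve (λ u v → pairing (λ k → h k u v) L) m
  pairing-convolve h m []            = sym (convolve-zero m λ _ _ → refl)
  pairing-convolve h m ((a , k) ∷ L) = trans (cong₂ _+_ (sym (convolve-* m a (h k))) (pairing-convolve h m L))
    (sym (convolve-+ m (λ u v → a * h k u v) (λ u v → pairing (λ k → h k u v) L)))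

  coeff-evalLaurent : ∀ L R m → coeff (evalLaurent L R) m ≡ pairing (λ k → coeff (R ^ᶻ k) m) L
  coeff-evalLaurent []            R m = constCoeff-0 m
  coeff-evalLaurent ((a , k) ∷ L) R m = cong (λ z → a * coeff (R ^ᶻ k) m + z) (coeff-evalLaurent L R m)

  -- F with each power r^k replaced by the series χ k.
  substitute : LSeries → (ℤ → PS) → PS
  substitute F χ .coeff  = convolve λ u v → pairing (λ k → coeff (χ k) v) (coeff F u)
  substitute F χ .padded = convolve-padded _ λ u v →
    trans (cong (pairing (λ k → coeff (χ k) (v ∷ʳ 0))) (padded F u)) (pairing-cong (coeff F u) λ k → padded (χ k) v)

  [r=]≋substitute : ∀ F R → F [r= R ] ≋ substitute F (R ^ᶻ_)
  [r=]≋substitute F R = ⟪ (λ m → convolve-cong m λ u v → coeff-evalLaurent (coeff F u) R v) ⟫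

  substitute-cong : ∀ F {χ χ′} → (∀ k → χ k ≋ χ′ k) → substitute F χ ≋ substitute F χ′
  substitute-cong F eq = ⟪ (λ m → convolve-cong m λ u v → pairing-cong (coeff F u) λ k → coeffs (eq k) v) ⟫

  substitute-+ : ∀ F χ χ′ → substitute F (λ k → χ k +ₛ χ′ k) ≋ substitute F χ +ₛ substitute F χ′
  substitute-+ F χ χ′ = ⟪ (λ m → trans
    (convolve-cong m λ u v → pairing-+ (λ k → coeff (χ k) v) (λ k → coeff (χ′ k) v) (coeff F u))
    (convolve-+ m (λ u v → pairing (λ k → coeff (χ k) v) (coeff F u)) (λ u v → pairing (λ k → coeff (χ′ k) v) (coeff F u)))) ⟫

  substitute-* : ∀ F G χ → G *ₛ substitute F χ ≋ substitute F (λ k → G *ₛ χ k)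
  substitute-* F G χ = ⟪ (λ m → ≡.begin
    convolve (λ s w → coeff G s * convolve (λ u v → pairing (λ k → coeff (χ k) v) (coeff F u)) w) m
      ≡.≡⟨ convolve-cong m (λ s w → trans (sym (convolve-* w (coeff G s) (λ u v → pairing (λ k → coeff (χ k) v) (coeff F u))))
           (convolve-cong w λ u v → sym (pairing-* (coeff G s) (λ k → coeff (χ k) v) (coeff F u)))) ⟩
    convolve (λ s w → convolve (λ u v → T u s v) w) m
      ≡.≡⟨ convolve-assoc m (λ s u v → T u s v) ⟨
    convolve (λ w v → convolve (λ s u → T u s v) w) m
      ≡.≡⟨ convolve-cong m (λ w v → convolve-swap w (λ s u → T u s v)) ⟩
    convolve (λ w v → convolve (λ u s → T u s v) w) m
      ≡.≡⟨ convolve-assoc m T ⟩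
    convolve (λ u w → convolve (λ s v → T u s v) w) m
      ≡.≡⟨ convolve-cong m (λ u w → pairing-convolve (λ k s v → coeff G s * coeff (χ k) v) w (coeff F u)) ⟨
    convolve (λ u w → pairing (λ k → coeff (G *ₛ χ k) w) (coeff F u)) m
      ≡.∎) ⟫
    where
    module ≡ = ≡-Reasoning
    T : Mon → Mon → Mon → ℚ
    T u s v = pairing (λ k → coeff G s * coeff (χ k) v) (coeff F u)

  substitute-· : ∀ F q χ → substitute F (λ k → q ·ₛ χ k) ≋ q ·ₛ substitute F χ
  substitute-· F q χ = ⟪ (λ m → trans
    (convolve-cong m λ u v → pairing-* q (λ k → coeff (χ k) v) (coeff F u))
    (convolve-* m q (λ u v → pairing (λ k → coeff (χ k) v) (coeff F u)))) ⟫

  FreeOfY₀ : LSeries → Set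
  FreeOfY₀ F = ∀ e u → coeff F (suc e ∷ u) ≡ []

  ∂-substitute : ∀ F χ → FreeOfY₀ F → ∂ (substitute F χ) ≋ substitute F (λ k → ∂ (χ k))
  ∂-substitute F χ free = ≋-slices λ e m → trans
    (cong (fromℕ (suc e) *_) (first (suc e) m χ))
    (trans (sym (convolve-* m (fromℕ (suc e)) (λ u v → pairing (λ k → coeff (χ k) (suc e ∷ v)) (coeff F (0 ∷ u)))))
      (trans (convolve-cong m λ u v → sym (pairing-* (fromℕ (suc e)) (λ k → coeff (χ k) (suc e ∷ v)) (coeff F (0 ∷ u))))
        (sym (first e m (λ k → ∂ (χ k))))))
    where
    first : ∀ e m χ → coeff (substitute F χ) (e ∷ m)
                      ≡ convolve (λ u v → pairing (λ k → coeff (χ k) (e ∷ v)) (coeff F (0 ∷ u))) m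
    first e m χ = trans (cong (λ z → x + z)
      (∑-zero e λ i → convolve-zero m λ u v → cong (pairing (λ k → coeff (χ k) (e ∸ suc i ∷ v))) (free i u))) (ℚ.+-identityʳ x)
      where
      x : ℚ
      x = convolve (λ u v → pairing (λ k → coeff (χ k) (e ∷ v)) (coeff F (0 ∷ u))) m

  constCoeff-[] : ∀ u → constCoeff {Laurent} [] [] u ≡ []
  constCoeff-[] []          = refl
  constCoeff-[] (zero  ∷ u) = constCoeff-[] u
  constCoeff-[] (suc _ ∷ u) = refl

  Z-freeOfY₀ : ∀ b → FreeOfY₀ (Z b)
  Z-freeOfY₀ b zero    u = constCoeff-[] u
  Z-freeOfY₀ b (suc e) u = refl

  -- Operators that multiply r^k by w k.
  record Diagonal (D : LSeries → LSeries) (w : ℤ → ℚ) : Set where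
    constructor mkDiagonal
    field pairing-diagonal : ∀ F u ψ → pairing ψ (coeff (D F) u) ≡ pairing (λ k → w k * ψ k) (coeff F u)
  open Diagonal

  pairing-map : ∀ (w ψ : ℤ → ℚ) L → pairing ψ (List.map (λ (a , k) → (w k * a , k)) L) ≡ pairing (λ k → w k * ψ k) L
  pairing-map w ψ []            = refl
  pairing-map w ψ ((a , k) ∷ L) = cong₂ _+_ (solve 3 (λ q a x → q :* a :* x := a :* (q :* x)) refl (w k) a (ψ k)) (pairing-map w ψ L)

  diagonal-scale : ∀ q → Diagonal (scaleₗ q) (λ _ → q)
  diagonal-scale q = mkDiagonal λ F u ψ → pairing-map (λ _ → q) ψ (coeff F u)

  diagonal-r∂r : Diagonal r∂r fromℤ
  diagonal-r∂r = mkDiagonal λ F u ψ → pairing-map fromℤ ψ (coeff F u)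

  diagonal-id : Diagonal id (λ _ → 1ℚ)
  diagonal-id = mkDiagonal λ F u ψ → pairing-cong (coeff F u) λ k → sym (ℚ.*-identityˡ (ψ k))

  diagonal-∘ : ∀ {D E w w′} → Diagonal D w → Diagonal E w′ → Diagonal (λ F → D (E F)) (λ k → w k * w′ k)
  diagonal-∘ {D} {E} {w} {w′} (mkDiagonal d) (mkDiagonal d′) = mkDiagonal λ F u ψ →
    trans (d (E F) u ψ) (trans (d′ F u (λ k → w k * ψ k))
      (pairing-cong (coeff F u) λ k → solve 3 (λ a b c → b :* (a :* c) := a :* b :* c) refl (w k) (w′ k) (ψ k)))

  diagonal-+ : ∀ {D E w w′} → Diagonal D w → Diagonal E w′ → Diagonal (λ F → D F +ₗ E F) (λ k → w k + w′ k)
  diagonal-+ {D} {E} {w} {w′} (mkDiagonal d) (mkDiagonal d′) = mkDiagonal λ F u ψ →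
    trans (pairing-++ ψ (coeff (D F) u) (coeff (E F) u))
      (trans (cong₂ _+_ (d F u ψ) (d′ F u ψ)) (trans (sym (pairing-+ (λ k → w k * ψ k) (λ k → w′ k * ψ k) (coeff F u)))
        (pairing-cong (coeff F u) λ k → sym (ℚ.*-distribʳ-+ (ψ k) (w k) (w′ k)))))

  diagonal-0 : Diagonal (λ _ → 0ₗ) (λ _ → 0ℚ)
  diagonal-0 = mkDiagonal λ F u ψ → trans (cong (pairing ψ) (constCoeff-[] u))
    (sym (trans (pairing-cong (coeff F u) λ k → ℚ.*-zeroˡ (ψ k)) (pairing-zero (coeff F u))))

  module _ where
    open RawSemiringDefs Operator-rawSemiring using () renaming (_^_ to _^ₒ_)

    diagonal-^ : ∀ {D w} → Diagonal D w → ∀ n → Diagonal (D ^ₒ n) (λ k → w k ^ℚ n)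
    diagonal-^ d zero    = diagonal-id
    diagonal-^ d (suc n) = diagonal-∘ d (diagonal-^ d n)

    diagonal-eval : ∀ (Q : Polynomial 2) q → Diagonal
      (eval Operator-rawSemiring scaleₗ Q (scaleₗ q ∷ r∂r ∷ []))
      (λ k → eval +-*-rawSemiring id Q (q ∷ fromℤ k ∷ []))
    diagonal-eval []                     q = diagonal-0
    diagonal-eval ((a , d ∷ e ∷ []) ∷ Q) q = diagonal-+
      (diagonal-∘ (diagonal-scale a) (diagonal-∘ (diagonal-^ (diagonal-scale q) d) (diagonal-∘ (diagonal-^ diagonal-r∂r e) diagonal-id)))
      (diagonal-eval Q q)

  pairing-shift : ∀ l ψ F u → pairing ψ (coeff (shiftₗ l F) u) ≡ pairing (λ k → ψ (l ℤ.+ k)) (coeff F u)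
  pairing-shift l ψ F u = go (coeff F u)
    where
    go : ∀ L → pairing ψ (List.map (λ (a , k) → (a , l ℤ.+ k)) L) ≡ pairing (λ k → ψ (l ℤ.+ k)) L
    go []            = refl
    go ((a , k) ∷ L) = cong (λ z → a * ψ (l ℤ.+ k) + z) (go L)

  substitute-diagonal : ∀ {D w} → Diagonal D w → ∀ F χ → substitute (D F) χ ≋ substitute F (λ k → w k ·ₛ χ k)
  substitute-diagonal d F χ = ⟪ (λ m → convolve-cong m λ u v → pairing-diagonal d F u (λ k → coeff (χ k) v)) ⟫

  substitute-shift : ∀ l F χ → substitute (shiftₗ l F) χ ≋ substitute F (λ k → χ (l ℤ.+ k))
  substitute-shift l F χ = ⟪ (λ m → convolve-cong m λ u v → pairing-shift l (λ k → coeff (χ k) v) F u) ⟫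

  -- w(r∂_r) Z⁽ᵇ⁾ at r = R.
  Z⟨_,_,_⟩ : ℕ → PS → (ℤ → ℚ) → PS
  Z⟨ b , R , w ⟩ = substitute (Z b) (λ k → w k ·ₛ R ^ᶻ k)

  Z⟨⟩-cong : ∀ b R {w w′} → (∀ k → w k ≡ w′ k) → Z⟨ b , R , w ⟩ ≋ Z⟨ b , R , w′ ⟩
  Z⟨⟩-cong b R eq = substitute-cong (Z b) λ k → ·ₛ-congˡ (R ^ᶻ k) (eq k)

  Z⟨⟩-+ : ∀ b R w w′ → Z⟨ b , R , (λ k → w k + w′ k) ⟩ ≋ Z⟨ b , R , w ⟩ +ₛ Z⟨ b , R , w′ ⟩
  Z⟨⟩-+ b R w w′ = ≋-trans
    (substitute-cong (Z b) λ k → ⟪ (λ m → ℚ.*-distribʳ-+ (coeff (R ^ᶻ k) m) (w k) (w′ k)) ⟫)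
    (substitute-+ (Z b) (λ k → w k ·ₛ R ^ᶻ k) (λ k → w′ k ·ₛ R ^ᶻ k))

  Z⟨⟩-* : ∀ b R q w → Z⟨ b , R , (λ k → q * w k) ⟩ ≋ q ·ₛ Z⟨ b , R , w ⟩
  Z⟨⟩-* b R q w = ≋-trans
    (substitute-cong (Z b) λ k → ⟪ (λ m → ℚ.*-assoc q (w k) (coeff (R ^ᶻ k) m)) ⟫)
    (substitute-· (Z b) q (λ k → w k ·ₛ R ^ᶻ k))

  module _ {b R} (isR : IsR b R) where
    open IsR isR

    R-invertible : R *ₛ inv R ≋ 1ₛ
    R-invertible = inv-inverseʳ R λ R₀≡0 → 1≢0 (trans (sym constantTerm≡1) R₀≡0)
      where
      1≢0 : 1ℚ ≢ 0ℚ
      1≢0 ()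

    open IntegerPowers R R-invertible

    Z⟨1⟩≋y₀ : Z⟨ b , R , (λ _ → 1ℚ) ⟩ ≋ y₀
    Z⟨1⟩≋y₀ = begin
      Z⟨ b , R , (λ _ → 1ℚ) ⟩      ≈⟨ substitute-cong (Z b) (λ k → ⟪ (λ m → ℚ.*-identityˡ (coeff (R ^ᶻ k) m)) ⟫) ⟩
      substitute (Z b) (R ^ᶻ_)     ≈⟨ [r=]≋substitute (Z b) R ⟨
      Z b [r= R ]                  ≈⟨ ⟪ Z[R]≈x_b ⟫ ⟩
      y₀                           ∎

    chain-rule : ∀ w → R *ₛ ∂ Z⟨ b , R , w ⟩ ≋ ∂ R *ₛ Z⟨ b , R , (λ k → fromℤ k * w k) ⟩
    chain-rule w = begin
      R *ₛ ∂ Z⟨ b , R , w ⟩                                       ≈⟨ PSR.*-congˡ (∂-substitute (Z b) (λ k → w k ·ₛ R ^ᶻ k) (Z-freeOfY₀ b)) ⟩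
      R *ₛ substitute (Z b) (λ k → ∂ (w k ·ₛ R ^ᶻ k))              ≈⟨ substitute-* (Z b) R (λ k → ∂ (w k ·ₛ R ^ᶻ k)) ⟩
      substitute (Z b) (λ k → R *ₛ ∂ (w k ·ₛ R ^ᶻ k))              ≈⟨ substitute-cong (Z b) term ⟩
      substitute (Z b) (λ k → ∂ R *ₛ ((fromℤ k * w k) ·ₛ R ^ᶻ k))  ≈⟨ substitute-* (Z b) (∂ R) (λ k → (fromℤ k * w k) ·ₛ R ^ᶻ k) ⟨
      ∂ R *ₛ Z⟨ b , R , (λ k → fromℤ k * w k) ⟩                    ∎
      where
      term : ∀ k → R *ₛ ∂ (w k ·ₛ R ^ᶻ k) ≋ ∂ R *ₛ ((fromℤ k * w k) ·ₛ R ^ᶻ k)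
      term k = begin
        R *ₛ ∂ (w k ·ₛ R ^ᶻ k)                       ≈⟨ PSR.*-congˡ (∂-·ₛ (w k) (R ^ᶻ k)) ⟩
        R *ₛ (w k ·ₛ ∂ (R ^ᶻ k))                     ≈⟨ *ₛ-·ₛ (w k) R (∂ (R ^ᶻ k)) ⟩
        w k ·ₛ (R *ₛ ∂ (R ^ᶻ k))                     ≈⟨ ·ₛ-cong (w k) (∂-^ᶻ k) ⟩
        w k ·ₛ (fromℤ k ·ₛ (R ^ᶻ k *ₛ ∂ R))          ≈⟨ ⟪ (λ m → regroup (w k) (fromℤ k) (coeff (R ^ᶻ k *ₛ ∂ R) m)) ⟫ ⟩
        (fromℤ k * w k) ·ₛ (R ^ᶻ k *ₛ ∂ R)           ≈⟨ ·ₛ-cong (fromℤ k * w k) (*ₛ-comm (R ^ᶻ k) (∂ R)) ⟩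
        (fromℤ k * w k) ·ₛ (∂ R *ₛ R ^ᶻ k)           ≈⟨ *ₛ-·ₛ (fromℤ k * w k) (∂ R) (R ^ᶻ k) ⟨
        ∂ R *ₛ ((fromℤ k * w k) ·ₛ R ^ᶻ k)           ∎
        where
        regroup : ∀ a b c → a * (b * c) ≡ b * a * c
        regroup = solve 3 (λ a b c → a :* (b :* c) := b :* a :* c) refl

    M̄-expansion : ∀ Q → M̄ Q b R ≋ R ^ᶻ (ℤ.- (+ b)) *ₛ
      Z⟨ b , R , (λ k → eval +-*-rawSemiring id Q (fromℕ b ∷ fromℤ (ℤ.- (+ b) ℤ.+ k) ∷ [])) ⟩
    M̄-expansion Q = begin
      M̄ Q b R                                                                   ≈⟨ [r=]≋substitute (D (shiftₗ -b (Z b))) R ⟩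
      substitute (D (shiftₗ -b (Z b))) (R ^ᶻ_)                                   ≈⟨ substitute-diagonal (diagonal-eval Q (fromℕ b)) (shiftₗ -b (Z b)) (R ^ᶻ_) ⟩
      substitute (shiftₗ -b (Z b)) (λ k → w k ·ₛ R ^ᶻ k)                         ≈⟨ substitute-shift -b (Z b) (λ k → w k ·ₛ R ^ᶻ k) ⟩
      substitute (Z b) (λ k → w (-b ℤ.+ k) ·ₛ R ^ᶻ (-b ℤ.+ k))                   ≈⟨ substitute-cong (Z b) (λ k → ≋-trans
                                                                                     (·ₛ-cong (w (-b ℤ.+ k)) (^ᶻ-+ -b k))
                                                                                     (≋-sym (*ₛ-·ₛ (w (-b ℤ.+ k)) (R ^ᶻ -b) (R ^ᶻ k)))) ⟩
      substitute (Z b) (λ k → R ^ᶻ -b *ₛ (w (-b ℤ.+ k) ·ₛ R ^ᶻ k))               ≈⟨ substitute-* (Z b) (R ^ᶻ -b) (λ k → w (-b ℤ.+ k) ·ₛ R ^ᶻ k) ⟨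
      R ^ᶻ -b *ₛ Z⟨ b , R , (λ k → w (-b ℤ.+ k)) ⟩                               ∎
      where
      -b : ℤ
      -b = ℤ.- (+ b)
      D : LSeries → LSeries
      D = eval Operator-rawSemiring scaleₗ Q (scaleₗ (fromℕ b) ∷ r∂r ∷ [])
      w : ℤ → ℚ
      w k = eval +-*-rawSemiring id Q (fromℕ b ∷ fromℤ k ∷ [])

  -- Differential polynomials

  open CommutativeSemigroupProperties PSR.*-commutativeSemigroup using () renaming (interchange to *ₛ-interchange)
  module ×-Solver = CommutativeMonoidSolver PSR.*-commutativeMonoid
  open ×-Solver using (_⊜_) renaming (_⊕_ to _⊛_)

  ratS-homo-* : ∀ p q → ratS (p * q) ≋ ratS p *ₛ ratS q
  ratS-homo-* p q = ≋-trans ⟪ constCoeff-* p q ⟫ (≋-sym (ratS-* p (ratS q)))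

  ∂-ratS-* : ∀ q F → ∂ (ratS q *ₛ F) ≋ ratS q *ₛ ∂ F
  ∂-ratS-* q F = ≋-trans (∂-cong (ratS-* q F)) (≋-trans (∂-·ₛ q F) (≋-sym (ratS-* q (∂ F))))

  evalₛ : ∀ {n} → Polynomial n → Vec PS n → PS
  evalₛ = eval PS-rawSemiring ratS

  monomialₛ : ∀ {n} → Vec PS n → Vec ℕ n → PS
  monomialₛ = evalMonomial PS-rawSemiring ratS

  monomial-one : ∀ {n} (as : Vec PS n) → monomialₛ as (Vec.replicate n 0) ≋ 1ₛ
  monomial-one []       = ≋-refl
  monomial-one (a ∷ as) = ≋-trans (*ₛ-identityˡ _) (monomial-one as)

  monomial-* : ∀ {n} (as : Vec PS n) es ds → monomialₛ as (Vec.zipWith ℕ._+_ es ds) ≋ monomialₛ as es *ₛ monomialₛ as ds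
  monomial-* []       []       []       = ≋-sym (*ₛ-identityˡ 1ₛ)
  monomial-* (a ∷ as) (e ∷ es) (d ∷ ds) = ≋-trans (*ₛ-cong (^ₛ-+ a e d) (monomial-* as es ds))
    (*ₛ-interchange (a ^ₛ e) (a ^ₛ d) (monomialₛ as es) (monomialₛ as ds))

  unit : ∀ {n} → Fin n → Vec ℕ n
  unit fzero    = 1 ∷ Vec.replicate _ 0
  unit (fsuc i) = 0 ∷ unit i

  monomial-unit : ∀ {n} (as : Vec PS n) i → monomialₛ as (unit i) ≋ Vec.lookup as i
  monomial-unit (a ∷ as) fzero    = ≋-trans (*ₛ-cong (PSR.*-identityʳ a) (monomial-one as)) (PSR.*-identityʳ a)
  monomial-unit (a ∷ as) (fsuc i) = ≋-trans (*ₛ-identityˡ _) (monomial-unit as i)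

  eval-++ : ∀ {n} (P Q : Polynomial n) as → evalₛ (P ++ Q) as ≋ evalₛ P as +ₛ evalₛ Q as
  eval-++ []             Q as = ≋-sym (PSR.+-identityˡ _)
  eval-++ ((q , es) ∷ P) Q as = ≋-trans (PSR.+-congˡ (eval-++ P Q as)) (≋-sym (PSR.+-assoc _ _ _))

  scaleTerm : ∀ {n} → ℚ × Vec ℕ n → Polynomial n → Polynomial n
  scaleTerm t              []             = []
  scaleTerm (p , ds) ((q , es) ∷ Q) = (p * q , Vec.zipWith ℕ._+_ ds es) ∷ scaleTerm (p , ds) Q

  _⊗_ : ∀ {n} → Polynomial n → Polynomial n → Polynomial n
  []      ⊗ Q = []
  (t ∷ P) ⊗ Q = scaleTerm t Q ++ (P ⊗ Q)

  eval-scaleTerm : ∀ {n} p ds (Q : Polynomial n) as → evalₛ (scaleTerm (p , ds) Q) as ≋ (ratS p *ₛ monomialₛ as ds) *ₛ evalₛ Q as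
  eval-scaleTerm p ds []             as = ≋-sym (PSR.zeroʳ _)
  eval-scaleTerm p ds ((q , es) ∷ Q) as = ≋-trans
    (+ₛ-cong (≋-trans (*ₛ-cong (ratS-homo-* p q) (monomial-* as ds es)) (*ₛ-interchange (ratS p) (ratS q) (monomialₛ as ds) (monomialₛ as es)))
      (eval-scaleTerm p ds Q as))
    (≋-sym (*ₛ-distribˡ (ratS p *ₛ monomialₛ as ds) (ratS q *ₛ monomialₛ as es) (evalₛ Q as)))

  eval-⊗ : ∀ {n} (P Q : Polynomial n) as → evalₛ (P ⊗ Q) as ≋ evalₛ P as *ₛ evalₛ Q as
  eval-⊗ []             Q as = ≋-sym (PSR.zeroˡ _)
  eval-⊗ ((p , ds) ∷ P) Q as = ≋-trans (eval-++ (scaleTerm (p , ds) Q) (P ⊗ Q) as)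
    (≋-trans (+ₛ-cong (eval-scaleTerm p ds Q as) (eval-⊗ P Q as)) (≋-sym (PSR.distribʳ (evalₛ Q as) (ratS p *ₛ monomialₛ as ds) (evalₛ P as))))

  sum-zipWith-+ : ∀ {n} (es ds : Vec ℕ n) → Vec.sum (Vec.zipWith ℕ._+_ es ds) ≡ Vec.sum es ℕ.+ Vec.sum ds
  sum-zipWith-+ []       []       = refl
  sum-zipWith-+ (e ∷ es) (d ∷ ds) = trans (cong (e ℕ.+ d ℕ.+_) (sum-zipWith-+ es ds)) (+-interchange e d (Vec.sum es) (Vec.sum ds))
    where open CommutativeSemigroupProperties ℕ.+-commutativeSemigroup using () renaming (interchange to +-interchange)

  sum-replicate-0 : ∀ n → Vec.sum (Vec.replicate n 0) ≡ 0
  sum-replicate-0 zero    = refl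
  sum-replicate-0 (suc n) = sum-replicate-0 n

  sum-unit : ∀ {n} (i : Fin n) → Vec.sum (unit i) ≡ 1
  sum-unit {suc n} fzero = cong suc (sum-replicate-0 n)
  sum-unit (fsuc i)      = sum-unit i

  homogeneous-scaleTerm : ∀ {n c d} p (ds : Vec ℕ (suc n)) Q → Vec.sum (Vec.tail ds) ≡ c → HomogeneousInTail d Q →
                          HomogeneousInTail (c ℕ.+ d) (scaleTerm (p , ds) Q)
  homogeneous-scaleTerm p ds       []                   eq []        = []
  homogeneous-scaleTerm p (d ∷ ds) ((q , e ∷ es) ∷ Q) eq (eq′ ∷ h) =
    trans (sum-zipWith-+ ds es) (cong₂ ℕ._+_ eq eq′) ∷ homogeneous-scaleTerm p (d ∷ ds) Q eq h

  homogeneous-⊗ : ∀ {n c d} (P Q : Polynomial (suc n)) → HomogeneousInTail c P → HomogeneousInTail d Q → HomogeneousInTail (c ℕ.+ d) (P ⊗ Q)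
  homogeneous-⊗ []             Q []       h′ = []
  homogeneous-⊗ ((p , ds) ∷ P) Q (eq ∷ h) h′ = ++⁺ (homogeneous-scaleTerm p ds Q eq h′) (homogeneous-⊗ P Q h h′)

  -- Φ b R is a polynomial in b, R, ∂R, …, ∂ⁿ⁻¹R, homogeneous of degree d in all
  -- of these but b.
  record DiffPoly (n d : ℕ) (Φ : ℕ → PS → PS) : Set where
    constructor mkDiffPoly
    field
      poly        : Polynomial (suc n)
      homogeneous : HomogeneousInTail d poly
      evaluates   : ∀ b R → evalAtDerivatives poly b R ≋ Φ b R
  open DiffPoly

  derivatives : ∀ n → ℕ → PS → Vec PS (suc n)
  derivatives n b R = ratS (fromℕ b) ∷ Vec.tabulate {n = n} (λ i → ∂^ (toℕ i) R)

  module _ {n : ℕ} where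

    dp-cong : ∀ {d Φ Ψ} → (∀ b R → Φ b R ≋ Ψ b R) → DiffPoly n d Φ → DiffPoly n d Ψ
    dp-cong eq (mkDiffPoly P h ev) = mkDiffPoly P h λ b R → ≋-trans (ev b R) (eq b R)

    dp-degree : ∀ {c d Φ} → c ≡ d → DiffPoly n c Φ → DiffPoly n d Φ
    dp-degree refl P = P

    dp-0 : ∀ {d} → DiffPoly n d (λ _ _ → 0ₛ)
    dp-0 = mkDiffPoly [] [] λ b R → ≋-refl

    dp-+ : ∀ {d Φ Ψ} → DiffPoly n d Φ → DiffPoly n d Ψ → DiffPoly n d (λ b R → Φ b R +ₛ Ψ b R)
    dp-+ (mkDiffPoly P h ev) (mkDiffPoly P′ h′ ev′) = mkDiffPoly (P ++ P′) (++⁺ h h′) λ b R →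
      ≋-trans (eval-++ P P′ (derivatives n b R)) (+ₛ-cong (ev b R) (ev′ b R))

    dp-* : ∀ {c d Φ Ψ} → DiffPoly n c Φ → DiffPoly n d Ψ → DiffPoly n (c ℕ.+ d) (λ b R → Φ b R *ₛ Ψ b R)
    dp-* (mkDiffPoly P h ev) (mkDiffPoly P′ h′ ev′) = mkDiffPoly (P ⊗ P′) (homogeneous-⊗ P P′ h h′) λ b R →
      ≋-trans (eval-⊗ P P′ (derivatives n b R)) (*ₛ-cong (ev b R) (ev′ b R))

    dp-monomial : ∀ q (es : Vec ℕ (suc n)) → DiffPoly n (Vec.sum (Vec.tail es)) (λ b R → ratS q *ₛ monomialₛ (derivatives n b R) es)
    dp-monomial q es = mkDiffPoly ((q , es) ∷ []) (refl ∷ []) λ b R → PSR.+-identityʳ _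

    dp-rat : ∀ q → DiffPoly n 0 (λ _ _ → ratS q)
    dp-rat q = dp-degree (sum-replicate-0 n)
      (dp-cong (λ b R → ≋-trans (PSR.*-congˡ (monomial-one (derivatives n b R))) (PSR.*-identityʳ (ratS q))) (dp-monomial q (Vec.replicate (suc n) 0)))

    dp-b : DiffPoly n 0 (λ b _ → ratS (fromℕ b))
    dp-b = dp-degree (sum-replicate-0 n)
      (dp-cong (λ b R → ≋-trans (*ₛ-identityˡ _) (monomial-unit (derivatives n b R) fzero)) (dp-monomial 1ℚ (unit fzero)))

    dp-∂^ : ∀ {k} → k < n → DiffPoly n 1 (λ _ R → ∂^ k R)
    dp-∂^ k<n = dp-degree (sum-unit i)
      (dp-cong (λ b R → ≋-trans (*ₛ-identityˡ _) (≋-trans (monomial-unit (derivatives n b R) (fsuc i))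
        (PSR.reflexive (trans (lookup∘tabulate (λ i → ∂^ (toℕ i) R) i) (cong (λ k → ∂^ k R) (toℕ-fromℕ< k<n))))))
        (dp-monomial 1ℚ (0 ∷ unit i)))
      where
      i : Fin n
      i = fromℕ< k<n

    dp-∂^-^ : ∀ {k} → k < n → ∀ e → DiffPoly n e (λ _ R → ∂^ k R ^ₛ e)
    dp-∂^-^ k<n zero    = dp-rat 1ℚ
    dp-∂^-^ k<n (suc e) = dp-* (dp-∂^ k<n) (dp-∂^-^ k<n e)

    dp-∂[∂^-^] : ∀ {k} → suc k < n → ∀ e → DiffPoly n e (λ _ R → ∂ (∂^ k R ^ₛ e))
    dp-∂[∂^-^] k<n zero    = dp-cong (λ _ _ → ≋-sym (∂-ratS 1ℚ)) dp-0
    dp-∂[∂^-^] k<n (suc e) = dp-cong (λ b R → ≋-sym (∂-* _ _))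
      (dp-+ (dp-* (dp-∂^ k<n) (dp-∂^-^ (ℕ.<⇒≤ k<n) e)) (dp-* (dp-∂^ (ℕ.<⇒≤ k<n)) (dp-∂[∂^-^] k<n e)))

    dp-product : ∀ {l} (k : Fin l → ℕ) → (∀ i → k i < n) → (es : Vec ℕ l) →
                 DiffPoly n (Vec.sum es) (λ _ R → monomialₛ (Vec.tabulate λ i → ∂^ (k i) R) es)
    dp-product k k<n []       = dp-rat 1ℚ
    dp-product k k<n (e ∷ es) = dp-* (dp-∂^-^ (k<n fzero) e) (dp-product (k ∘ fsuc) (k<n ∘ fsuc) es)

    dp-∂-product : ∀ {l} (k : Fin l → ℕ) → (∀ i → suc (k i) < n) → (es : Vec ℕ l) →
                   DiffPoly n (Vec.sum es) (λ _ R → ∂ (monomialₛ (Vec.tabulate λ i → ∂^ (k i) R) es))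
    dp-∂-product k k<n []       = dp-cong (λ _ _ → ≋-sym (∂-ratS 1ℚ)) dp-0
    dp-∂-product k k<n (e ∷ es) = dp-cong (λ b R → ≋-sym (∂-* _ _))
      (dp-+ (dp-* (dp-∂[∂^-^] (k<n fzero) e) (dp-product (k ∘ fsuc) (λ i → ℕ.<⇒≤ (k<n (fsuc i))) es))
            (dp-* (dp-∂^-^ (ℕ.<⇒≤ (k<n fzero)) e) (dp-∂-product (k ∘ fsuc) (k<n ∘ fsuc) es)))

    dp-rat-b^ : ∀ {d Φ} q e → DiffPoly n d Φ → DiffPoly n d (λ b R → ratS q *ₛ (ratS (fromℕ b) ^ₛ e *ₛ Φ b R))
    dp-rat-b^ q e P = dp-* (dp-rat q) (dp-* (b^ e) P)
      where
      b^ : ∀ e → DiffPoly n 0 (λ b _ → ratS (fromℕ b) ^ₛ e)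
      b^ zero    = dp-rat 1ℚ
      b^ (suc e) = dp-* dp-b (b^ e)

  ∂-rat^-* : ∀ q e F → ∂ (ratS q ^ₛ e *ₛ F) ≋ ratS q ^ₛ e *ₛ ∂ F
  ∂-rat^-* q zero    F = ∂-ratS-* 1ℚ F
  ∂-rat^-* q (suc e) F = begin
    ∂ (ratS q *ₛ ratS q ^ₛ e *ₛ F)        ≈⟨ ∂-cong (*ₛ-assoc (ratS q) (ratS q ^ₛ e) F) ⟩
    ∂ (ratS q *ₛ (ratS q ^ₛ e *ₛ F))      ≈⟨ ∂-ratS-* q (ratS q ^ₛ e *ₛ F) ⟩
    ratS q *ₛ ∂ (ratS q ^ₛ e *ₛ F)        ≈⟨ PSR.*-congˡ (∂-rat^-* q e F) ⟩
    ratS q *ₛ (ratS q ^ₛ e *ₛ ∂ F)        ≈⟨ *ₛ-assoc (ratS q) (ratS q ^ₛ e) (∂ F) ⟨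
    ratS q *ₛ ratS q ^ₛ e *ₛ ∂ F          ∎

  dp-weaken : ∀ {n d Φ} → DiffPoly n d Φ → DiffPoly (suc n) d Φ
  dp-weaken {n} {d} (mkDiffPoly P h ev) = dp-cong ev (go P h)
    where
    go : ∀ P → HomogeneousInTail d P → DiffPoly (suc n) d (evalAtDerivatives {n} P)
    go []                 []       = dp-0
    go ((q , e ∷ es) ∷ P) (eq ∷ h) = dp-+
      (dp-rat-b^ q e (dp-degree eq (dp-product toℕ (λ i → ℕ.<⇒≤ (s≤s (toℕ<n i))) es)))
      (go P h)

  dp-∂ : ∀ {n d Φ} → DiffPoly n d Φ → DiffPoly (suc n) d (λ b R → ∂ (Φ b R))
  dp-∂ {n} {d} (mkDiffPoly P h ev) = dp-cong (λ b R → ∂-cong (ev b R)) (go P h)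
    where
    go : ∀ P → HomogeneousInTail d P → DiffPoly (suc n) d (λ b R → ∂ (evalAtDerivatives {n} P b R))
    go []                 []       = dp-cong (λ _ _ → ≋-sym (∂-ratS 0ℚ)) dp-0
    go ((q , e ∷ es) ∷ P) (eq ∷ h) = dp-cong
      (λ b R → ≋-sym (≋-trans (∂-+ _ _) (PSR.+-congʳ (≋-trans (∂-ratS-* q _) (PSR.*-congˡ (∂-rat^-* (fromℕ b) e _))))))
      (dp-+ (dp-rat-b^ q e (dp-degree eq (dp-∂-product toℕ (λ i → s≤s (toℕ<n i)) es)))
            (go P h))

  -- Moments

  ∂-^ : ∀ F n → F *ₛ ∂ (F ^ₛ n) ≋ fromℕ n ·ₛ (F ^ₛ n *ₛ ∂ F)
  ∂-^ F zero    = ≋-trans (PSR.*-congˡ (∂-ratS 1ℚ)) (≋-trans (PSR.zeroʳ F) (≋-trans (≋-sym (PSR.zeroˡ (1ₛ *ₛ ∂ F))) (ratS-* 0ℚ (1ₛ *ₛ ∂ F))))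
  ∂-^ F (suc n) = begin
    F *ₛ ∂ (F *ₛ F ^ₛ n)                                          ≈⟨ PSR.*-congˡ (∂-* F (F ^ₛ n)) ⟩
    F *ₛ (∂ F *ₛ F ^ₛ n +ₛ F *ₛ ∂ (F ^ₛ n))                       ≈⟨ PSR.*-congˡ (+ₛ-cong (*ₛ-comm (∂ F) (F ^ₛ n)) (∂-^ F n)) ⟩
    F *ₛ (F ^ₛ n *ₛ ∂ F +ₛ fromℕ n ·ₛ (F ^ₛ n *ₛ ∂ F))            ≈⟨ PSR.*-congˡ ⟪ (λ m → merge (fromℕ n) (coeff (F ^ₛ n *ₛ ∂ F) m)) ⟫ ⟩
    F *ₛ ((1ℚ + fromℕ n) ·ₛ (F ^ₛ n *ₛ ∂ F))                      ≈⟨ *ₛ-·ₛ (1ℚ + fromℕ n) F (F ^ₛ n *ₛ ∂ F) ⟩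
    (1ℚ + fromℕ n) ·ₛ (F *ₛ (F ^ₛ n *ₛ ∂ F))                      ≈⟨ ·ₛ-cong (1ℚ + fromℕ n) (≋-sym (*ₛ-assoc F (F ^ₛ n) (∂ F))) ⟩
    (1ℚ + fromℕ n) ·ₛ (F ^ₛ suc n *ₛ ∂ F)                         ≈⟨ ·ₛ-congˡ (F ^ₛ suc n *ₛ ∂ F) (fromℕ-suc n) ⟨
    fromℕ (suc n) ·ₛ (F ^ₛ suc n *ₛ ∂ F)                          ∎
    where
    merge : ∀ q x → x + q * x ≡ (1ℚ + q) * x
    merge = solve 2 (λ q x → x :+ q :* x := (con 1ℚ :+ q) :* x) refl

  -- The quotient rule: A = R Φ / X with X = (∂R)ⁿ is differentiated without dividing.
  derivative-step : ∀ R A A₁ Φ n → A *ₛ ∂ R ^ₛ n ≋ R *ₛ Φ → R *ₛ ∂ A ≋ ∂ R *ₛ A₁ →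
    A₁ *ₛ (∂ R *ₛ (∂ R *ₛ ∂ R ^ₛ n)) ≋
    R *ₛ (∂ R *ₛ (∂ R *ₛ Φ) +ₛ R *ₛ (∂ R *ₛ ∂ Φ) +ₛ ratS (- fromℕ n) *ₛ (R *ₛ (∂ (∂ R) *ₛ Φ)))
  derivative-step R A A₁ Φ n AX≋RΦ R∂A≋R′A₁ = begin
    A₁ *ₛ (R′ *ₛ (R′ *ₛ X))
      ≈⟨ ×-Solver.solve 3 (λ a r x → (a ⊛ (r ⊛ (r ⊛ x))) ⊜ ((r ⊛ a) ⊛ (r ⊛ x))) ≋-refl A₁ R′ X ⟩
    (R′ *ₛ A₁) *ₛ (R′ *ₛ X)
      ≈⟨ PSR.*-congʳ R∂A≋R′A₁ ⟨
    (R *ₛ ∂ A) *ₛ (R′ *ₛ X)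
      ≈⟨ ×-Solver.solve 4 (λ r a r′ x → ((r ⊛ a) ⊛ (r′ ⊛ x)) ⊜ ((r ⊛ r′) ⊛ (a ⊛ x))) ≋-refl R (∂ A) R′ X ⟩
    (R *ₛ R′) *ₛ (∂ A *ₛ X)
      ≈⟨ isolate (fromℕ n) product-rule ⟩
    (R *ₛ R′) *ₛ (R′ *ₛ Φ +ₛ R *ₛ ∂ Φ) +ₛ (- fromℕ n) ·ₛ (R *ₛ (R *ₛ (R″ *ₛ Φ)))
      ≈⟨ +ₛ-cong (≋-trans (*ₛ-assoc R R′ _) (PSR.*-congˡ (≋-trans (*ₛ-distribˡ R′ (R′ *ₛ Φ) (R *ₛ ∂ Φ)) (PSR.+-congˡ (x∙yz≋y∙xz R′ R (∂ Φ))))))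
           (≋-trans (≋-sym (*ₛ-·ₛ (- fromℕ n) R (R *ₛ (R″ *ₛ Φ)))) (PSR.*-congˡ (≋-sym (ratS-* (- fromℕ n) (R *ₛ (R″ *ₛ Φ)))))) ⟩
    R *ₛ (R′ *ₛ (R′ *ₛ Φ) +ₛ R *ₛ (R′ *ₛ ∂ Φ)) +ₛ R *ₛ (ratS (- fromℕ n) *ₛ (R *ₛ (R″ *ₛ Φ)))
      ≈⟨ *ₛ-distribˡ R _ _ ⟨
    R *ₛ (R′ *ₛ (R′ *ₛ Φ) +ₛ R *ₛ (R′ *ₛ ∂ Φ) +ₛ ratS (- fromℕ n) *ₛ (R *ₛ (R″ *ₛ Φ))) ∎
    where
    R′ R″ X : PS
    R′ = ∂ R
    R″ = ∂ (∂ R)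
    X  = ∂ R ^ₛ n

    lastTerm : (R *ₛ R′) *ₛ (A *ₛ ∂ X) ≋ fromℕ n ·ₛ (R *ₛ (R *ₛ (R″ *ₛ Φ)))
    lastTerm = begin
      (R *ₛ R′) *ₛ (A *ₛ ∂ X)                    ≈⟨ ×-Solver.solve 4 (λ r r′ a x → ((r ⊛ r′) ⊛ (a ⊛ x)) ⊜ ((r ⊛ a) ⊛ (r′ ⊛ x))) ≋-refl R R′ A (∂ X) ⟩
      (R *ₛ A) *ₛ (R′ *ₛ ∂ X)                    ≈⟨ PSR.*-congˡ (∂-^ R′ n) ⟩
      (R *ₛ A) *ₛ (fromℕ n ·ₛ (X *ₛ R″))         ≈⟨ *ₛ-·ₛ (fromℕ n) (R *ₛ A) (X *ₛ R″) ⟩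
      fromℕ n ·ₛ ((R *ₛ A) *ₛ (X *ₛ R″))         ≈⟨ ·ₛ-cong (fromℕ n) (×-Solver.solve 4 (λ r a x r″ → ((r ⊛ a) ⊛ (x ⊛ r″)) ⊜ ((r ⊛ r″) ⊛ (a ⊛ x))) ≋-refl R A X R″) ⟩
      fromℕ n ·ₛ ((R *ₛ R″) *ₛ (A *ₛ X))         ≈⟨ ·ₛ-cong (fromℕ n) (PSR.*-congˡ AX≋RΦ) ⟩
      fromℕ n ·ₛ ((R *ₛ R″) *ₛ (R *ₛ Φ))         ≈⟨ ·ₛ-cong (fromℕ n) (×-Solver.solve 3 (λ r r″ φ → ((r ⊛ r″) ⊛ (r ⊛ φ)) ⊜ (r ⊛ (r ⊛ (r″ ⊛ φ)))) ≋-refl R R″ Φ) ⟩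
      fromℕ n ·ₛ (R *ₛ (R *ₛ (R″ *ₛ Φ)))         ∎

    product-rule : (R *ₛ R′) *ₛ (∂ A *ₛ X) +ₛ fromℕ n ·ₛ (R *ₛ (R *ₛ (R″ *ₛ Φ))) ≋ (R *ₛ R′) *ₛ (R′ *ₛ Φ +ₛ R *ₛ ∂ Φ)
    product-rule = begin
      (R *ₛ R′) *ₛ (∂ A *ₛ X) +ₛ fromℕ n ·ₛ (R *ₛ (R *ₛ (R″ *ₛ Φ)))    ≈⟨ PSR.+-congˡ lastTerm ⟨
      (R *ₛ R′) *ₛ (∂ A *ₛ X) +ₛ (R *ₛ R′) *ₛ (A *ₛ ∂ X)              ≈⟨ *ₛ-distribˡ (R *ₛ R′) _ _ ⟨
      (R *ₛ R′) *ₛ (∂ A *ₛ X +ₛ A *ₛ ∂ X)                             ≈⟨ PSR.*-congˡ (∂-* A X) ⟨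
      (R *ₛ R′) *ₛ ∂ (A *ₛ X)                                         ≈⟨ PSR.*-congˡ (∂-cong AX≋RΦ) ⟩
      (R *ₛ R′) *ₛ ∂ (R *ₛ Φ)                                         ≈⟨ PSR.*-congˡ (∂-* R Φ) ⟩
      (R *ₛ R′) *ₛ (R′ *ₛ Φ +ₛ R *ₛ ∂ Φ)                              ∎

    isolate : ∀ q {B C D} → B +ₛ q ·ₛ C ≋ D → B ≋ D +ₛ (- q) ·ₛ C
    isolate q {B} {C} {D} ⟪ eq ⟫ = ⟪ (λ m → trans (move q (coeff B m) (coeff C m)) (cong (_+ - q * coeff C m) (eq m))) ⟫
      where
      move : ∀ q b c → b ≡ b + q * c + - q * c
      move = solve 3 (λ q b c → b := b :+ q :* c :+ (:- q) :* c) refl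

  -- k · w(b, k) applied to Z⁽ᵇ⁾ is R · numerator / (∂R)²ⁿ⁺¹.
  record Representable (n : ℕ) (w : ℕ → ℤ → ℚ) : Set where
    field
      numerator  : ℕ → PS → PS
      diffPoly    : DiffPoly (2 ℕ.+ n) (2 ℕ.* n) numerator
      represents  : ∀ {b R} → IsR b R → Z⟨ b , R , (λ k → fromℤ k * w b k) ⟩ *ₛ ∂ R ^ₛ (2 ℕ.* n ℕ.+ 1) ≋ R *ₛ numerator b R
  open Representable

  representable-cong : ∀ {n w w′} → (∀ b k → w b k ≡ w′ b k) → Representable n w → Representable n w′
  representable-cong eq ρ .numerator = ρ .numerator
  representable-cong eq ρ .diffPoly  = ρ .diffPoly
  representable-cong eq ρ .represents {b} {R} isR =
    ≋-trans (PSR.*-congʳ (Z⟨⟩-cong b R λ k → cong (fromℤ k *_) (sym (eq b k)))) (ρ .represents isR)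

  representable-one : Representable 0 (λ _ _ → 1ℚ)
  representable-one .numerator _ _ = 1ₛ
  representable-one .diffPoly      = dp-rat 1ℚ
  representable-one .represents {b} {R} isR = begin
    Z⟨ b , R , (λ k → fromℤ k * 1ℚ) ⟩ *ₛ (∂ R *ₛ 1ₛ)       ≈⟨ PSR.*-congˡ (PSR.*-identityʳ (∂ R)) ⟩
    Z⟨ b , R , (λ k → fromℤ k * 1ℚ) ⟩ *ₛ ∂ R               ≈⟨ *ₛ-comm _ (∂ R) ⟩
    ∂ R *ₛ Z⟨ b , R , (λ k → fromℤ k * 1ℚ) ⟩               ≈⟨ chain-rule isR (λ _ → 1ℚ) ⟨
    R *ₛ ∂ Z⟨ b , R , (λ _ → 1ℚ) ⟩                         ≈⟨ PSR.*-congˡ (≋-trans (∂-cong (Z⟨1⟩≋y₀ isR)) ∂-y₀) ⟩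
    R *ₛ 1ₛ                                                ∎

  representable-+ : ∀ {n w w′} → Representable n w → Representable n w′ → Representable n (λ b k → w b k + w′ b k)
  representable-+ ρ ρ′ .numerator b R = ρ .numerator b R +ₛ ρ′ .numerator b R
  representable-+ ρ ρ′ .diffPoly      = dp-+ (ρ .diffPoly) (ρ′ .diffPoly)
  representable-+ {n} {w} {w′} ρ ρ′ .represents {b} {R} isR = begin
    Z⟨ b , R , (λ k → fromℤ k * (w b k + w′ b k)) ⟩ *ₛ X
      ≈⟨ PSR.*-congʳ (≋-trans (Z⟨⟩-cong b R λ k → ℚ.*-distribˡ-+ (fromℤ k) (w b k) (w′ b k)) (Z⟨⟩-+ b R (λ k → fromℤ k * w b k) (λ k → fromℤ k * w′ b k))) ⟩
    (Z⟨ b , R , (λ k → fromℤ k * w b k) ⟩ +ₛ Z⟨ b , R , (λ k → fromℤ k * w′ b k) ⟩) *ₛ X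
      ≈⟨ PSR.distribʳ X _ _ ⟩
    Z⟨ b , R , (λ k → fromℤ k * w b k) ⟩ *ₛ X +ₛ Z⟨ b , R , (λ k → fromℤ k * w′ b k) ⟩ *ₛ X
      ≈⟨ +ₛ-cong (ρ .represents isR) (ρ′ .represents isR) ⟩
    R *ₛ ρ .numerator b R +ₛ R *ₛ ρ′ .numerator b R
      ≈⟨ *ₛ-distribˡ R _ _ ⟨
    R *ₛ (ρ .numerator b R +ₛ ρ′ .numerator b R) ∎
    where
    X : PS
    X = ∂ R ^ₛ (2 ℕ.* n ℕ.+ 1)

  representable-* : ∀ {n w} (q : ℕ → ℚ) → DiffPoly (2 ℕ.+ n) 0 (λ b _ → ratS (q b)) →
                    Representable n w → Representable n (λ b k → q b * w b k)
  representable-* q qP ρ .numerator b R = ratS (q b) *ₛ ρ .numerator b R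
  representable-* q qP ρ .diffPoly      = dp-* qP (ρ .diffPoly)
  representable-* {n} {w} q qP ρ .represents {b} {R} isR = begin
    Z⟨ b , R , (λ k → fromℤ k * (q b * w b k)) ⟩ *ₛ X
      ≈⟨ PSR.*-congʳ (≋-trans (Z⟨⟩-cong b R λ k → swap (fromℤ k) (q b) (w b k)) (Z⟨⟩-* b R (q b) (λ k → fromℤ k * w b k))) ⟩
    (q b ·ₛ Z⟨ b , R , (λ k → fromℤ k * w b k) ⟩) *ₛ X
      ≈⟨ ·ₛ-*ₛ (q b) _ X ⟩
    q b ·ₛ (Z⟨ b , R , (λ k → fromℤ k * w b k) ⟩ *ₛ X)
      ≈⟨ ·ₛ-cong (q b) (ρ .represents isR) ⟩
    q b ·ₛ (R *ₛ ρ .numerator b R)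
      ≈⟨ *ₛ-·ₛ (q b) R (ρ .numerator b R) ⟨
    R *ₛ (q b ·ₛ ρ .numerator b R)
      ≈⟨ PSR.*-congˡ (ratS-* (q b) (ρ .numerator b R)) ⟨
    R *ₛ (ratS (q b) *ₛ ρ .numerator b R) ∎
    where
    X : PS
    X = ∂ R ^ₛ (2 ℕ.* n ℕ.+ 1)
    swap : ∀ a b c → a * (b * c) ≡ b * (a * c)
    swap = solve 3 (λ a b c → a :* (b :* c) := b :* (a :* c)) refl

  double-suc : ∀ n → 2 ℕ.* suc n ≡ suc (suc (2 ℕ.* n))
  double-suc n = cong suc (ℕ.+-suc n (n ℕ.+ 0))

  ^-double-suc : ∀ F n → F ^ₛ (2 ℕ.* suc n ℕ.+ 1) ≋ F *ₛ (F *ₛ F ^ₛ (2 ℕ.* n ℕ.+ 1))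
  ^-double-suc F n = PSR.reflexive (cong (λ l → F ^ₛ (l ℕ.+ 1)) (double-suc n))

  module _ {n : ℕ} where

    dp-R : ∀ {l} → DiffPoly (suc l) 1 (λ _ R → R)
    dp-R = dp-∂^ (s≤s z≤n)

    dp-∂R : ∀ {l} → DiffPoly (2 ℕ.+ l) 1 (λ _ R → ∂ R)
    dp-∂R = dp-∂^ (s≤s (s≤s z≤n))

    representable-raise : ∀ {w} → Representable n w → Representable (suc n) w
    representable-raise ρ .numerator b R = ∂ R *ₛ (∂ R *ₛ ρ .numerator b R)
    representable-raise ρ .diffPoly      = dp-degree (sym (double-suc n))
      (dp-* dp-∂R (dp-* dp-∂R (dp-weaken (ρ .diffPoly))))
    representable-raise {w} ρ .represents {b} {R} isR = begin
      A *ₛ ∂ R ^ₛ (2 ℕ.* suc n ℕ.+ 1)               ≈⟨ PSR.*-congˡ (^-double-suc (∂ R) n) ⟩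
      A *ₛ (∂ R *ₛ (∂ R *ₛ X))                      ≈⟨ ×-Solver.solve 3 (λ a r x → (a ⊛ (r ⊛ (r ⊛ x))) ⊜ (r ⊛ (r ⊛ (a ⊛ x)))) ≋-refl A (∂ R) X ⟩
      ∂ R *ₛ (∂ R *ₛ (A *ₛ X))                      ≈⟨ PSR.*-congˡ (PSR.*-congˡ (ρ .represents isR)) ⟩
      ∂ R *ₛ (∂ R *ₛ (R *ₛ ρ .numerator b R))       ≈⟨ ×-Solver.solve 3 (λ r′ r φ → (r′ ⊛ (r′ ⊛ (r ⊛ φ))) ⊜ (r ⊛ (r′ ⊛ (r′ ⊛ φ)))) ≋-refl (∂ R) R (ρ .numerator b R) ⟩
      R *ₛ (∂ R *ₛ (∂ R *ₛ ρ .numerator b R))       ∎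
      where
      A X : PS
      A = Z⟨ b , R , (λ k → fromℤ k * w b k) ⟩
      X = ∂ R ^ₛ (2 ℕ.* n ℕ.+ 1)

    representable-k* : ∀ {w} → Representable n w → Representable (suc n) (λ b k → fromℤ k * w b k)
    representable-k* ρ .numerator b R = ∂ R *ₛ (∂ R *ₛ Φ) +ₛ R *ₛ (∂ R *ₛ ∂ Φ) +ₛ ratS (- fromℕ (2 ℕ.* n ℕ.+ 1)) *ₛ (R *ₛ (∂ (∂ R) *ₛ Φ))
      where
      Φ : PS
      Φ = ρ .numerator b R
    representable-k* ρ .diffPoly = dp-degree (sym (double-suc n))
      (dp-+ (dp-+ (dp-* dp-∂R (dp-* dp-∂R (dp-weaken (ρ .diffPoly)))) (dp-* dp-R (dp-* dp-∂R (dp-∂ (ρ .diffPoly)))))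
            (dp-* (dp-rat (- fromℕ (2 ℕ.* n ℕ.+ 1))) (dp-* dp-R (dp-* (dp-∂^ (s≤s (s≤s (s≤s z≤n)))) (dp-weaken (ρ .diffPoly))))))
    representable-k* {w} ρ .represents {b} {R} isR = ≋-trans (PSR.*-congˡ (^-double-suc (∂ R) n))
      (derivative-step R Z⟨ b , R , (λ k → fromℤ k * w b k) ⟩ Z⟨ b , R , (λ k → fromℤ k * (fromℤ k * w b k)) ⟩
        (ρ .numerator b R) (2 ℕ.* n ℕ.+ 1) (ρ .represents isR) (chain-rule isR (λ k → fromℤ k * w b k)))

  fromℤ-neg : ∀ n → fromℤ (ℤ.- (+ n)) ≡ - fromℕ n
  fromℤ-neg zero    = refl
  fromℤ-neg (suc n) = refl

  representable-⟦⟧ : ∀ {n} (η : BPoly n) → Representable n (λ b k → ⟦ η ⟧ (fromℕ b) (fromℤ (ℤ.- (+ b) ℤ.+ k)))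
  representable-⟦⟧ one       = representable-one
  representable-⟦⟧ (η ⊕ ζ)   = representable-+ (representable-⟦⟧ η) (representable-⟦⟧ ζ)
  representable-⟦⟧ (q ⊙ η)   = representable-* (λ _ → q) (dp-rat q) (representable-⟦⟧ η)
  representable-⟦⟧ (b⊙ η)    = representable-* fromℕ dp-b (representable-⟦⟧ η)
  representable-⟦⟧ (raise η) = representable-raise (representable-⟦⟧ η)
  representable-⟦⟧ (j⊙ η)    = representable-cong
    (λ b k → shift (fromℕ b) (fromℤ k) (⟦ η ⟧ (fromℕ b) (fromℤ (ℤ.- (+ b) ℤ.+ k)))
               (trans (fromℤ-+ (ℤ.- (+ b)) k) (cong (_+ fromℤ k) (fromℤ-neg b))))
    (representable-+ (representable-k* ρ) (representable-raise (representable-* (λ _ → - 1ℚ) (dp-rat (- 1ℚ)) (representable-* fromℕ dp-b ρ))))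
    where
    ρ = representable-⟦⟧ η
    shift : ∀ β κ y {j} → j ≡ - β + κ → κ * y + - 1ℚ * (β * y) ≡ j * y
    shift β κ y refl = solve 3 (λ β κ y → κ :* y :+ con (- 1ℚ) :* (β :* y) := (:- β :+ κ) :* y) refl β κ y

  constantTerm-^≢0 : ∀ F n → constantTerm F ≢ 0ℚ → constantTerm (F ^ₛ n) ≢ 0ℚ
  constantTerm-^≢0 F zero    F₀≢0 ()
  constantTerm-^≢0 F (suc n) F₀≢0 eq =
    constantTerm-^≢0 F n F₀≢0 (*-cancelˡ F₀≢0 (trans eq (sym (ℚ.*-zeroʳ (constantTerm F)))))

  ∂R-constantTerm≢0 : ∀ {b R} → IsR b R → constantTerm (∂ R) ≢ 0ℚ
  ∂R-constantTerm≢0 {b} {R} isR R′₀≡0 = 0≢1 (trans (sym (trans (cong (λ z → a * (z * 1ℚ)) R′₀≡0) (ℚ.*-zeroʳ a)))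
    (trans (coeffs (representable-one .represents isR) []) (cong (_* 1ℚ) (IsR.constantTerm≡1 isR))))
    where
    a : ℚ
    a = constantTerm Z⟨ b , R , (λ k → fromℤ k * 1ℚ) ⟩
    0≢1 : 0ℚ ≢ 1ℚ * 1ℚ
    0≢1 ()

  moment-formula : ∀ {p w} Q (ρ : Representable p w) →
    (∀ b k → eval +-*-rawSemiring id Q (fromℕ b ∷ fromℤ (ℤ.- (+ b) ℤ.+ k) ∷ []) ≡ fromℤ k * w b k) →
    ∀ b R → IsR b R →
    M̄ Q b R ≋ ((R ^ᶻ (+ 1 ℤ.- + b)) /ₛ (∂ R ^ₛ (2 ℕ.* p ℕ.+ 1))) *ₛ evalAtDerivatives {2 ℕ.+ p} (poly (ρ .diffPoly)) b R
  moment-formula {p} {w} Q ρ weight b R isR = begin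
    M̄ Q b R                       ≈⟨ M̄-expansion isR Q ⟩
    R⁻ᵇ *ₛ Z⟨ b , R , (λ k → eval +-*-rawSemiring id Q (fromℕ b ∷ fromℤ (ℤ.- (+ b) ℤ.+ k) ∷ [])) ⟩
                                  ≈⟨ PSR.*-congˡ (Z⟨⟩-cong b R (weight b)) ⟩
    R⁻ᵇ *ₛ A                      ≈⟨ PSR.*-congˡ (PSR.*-identityʳ A) ⟨
    R⁻ᵇ *ₛ (A *ₛ 1ₛ)              ≈⟨ PSR.*-congˡ (PSR.*-congˡ (inv-inverseʳ X (constantTerm-^≢0 (∂ R) (2 ℕ.* p ℕ.+ 1) (∂R-constantTerm≢0 isR)))) ⟨
    R⁻ᵇ *ₛ (A *ₛ (X *ₛ inv X))    ≈⟨ ×-Solver.solve 4 (λ r a x y → (r ⊛ (a ⊛ (x ⊛ y))) ⊜ ((r ⊛ y) ⊛ (a ⊛ x))) ≋-refl R⁻ᵇ A X (inv X) ⟩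
    (R⁻ᵇ *ₛ inv X) *ₛ (A *ₛ X)    ≈⟨ PSR.*-congˡ (ρ .represents isR) ⟩
    (R⁻ᵇ *ₛ inv X) *ₛ (R *ₛ Φ)    ≈⟨ ×-Solver.solve 4 (λ r y s φ → ((r ⊛ y) ⊛ (s ⊛ φ)) ⊜ (((s ⊛ r) ⊛ y) ⊛ φ)) ≋-refl R⁻ᵇ (inv X) R Φ ⟩
    R *ₛ R⁻ᵇ *ₛ inv X *ₛ Φ        ≈⟨ *ₛ-cong (PSR.*-congʳ (IntegerPowers.^ᶻ-suc R (R-invertible isR) (ℤ.- (+ b)))) (evaluates (ρ .diffPoly) b R) ⟨
    ((R ^ᶻ (+ 1 ℤ.- + b)) /ₛ X) *ₛ evalAtDerivatives {2 ℕ.+ p} (poly (ρ .diffPoly)) b R ∎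
    where
    R⁻ᵇ A X Φ : PS
    R⁻ᵇ = R ^ᶻ (ℤ.- (+ b))
    A   = Z⟨ b , R , (λ k → fromℤ k * w b k) ⟩
    X   = ∂ R ^ₛ (2 ℕ.* p ℕ.+ 1)
    Φ   = ρ .numerator b R

  b+[-b+k]≡k : ∀ b k → fromℕ b + fromℤ (ℤ.- (+ b) ℤ.+ k) ≡ fromℤ k
  b+[-b+k]≡k b k = trans (sym (fromℤ-+ (+ b) (ℤ.- (+ b) ℤ.+ k)))
    (cong fromℤ (trans (sym (ℤ.+-assoc (+ b) (ℤ.- (+ b)) k)) (trans (cong (ℤ._+ k) (ℤ.+-inverseʳ (+ b))) (ℤ.+-identityˡ k))))

  momentPolynomial : ∀ {p} Q →
    (Σ (BPoly p) λ η → ∀ b x → eval +-*-rawSemiring id Q (fromℕ b ∷ x ∷ []) ≡ (fromℕ b + x) * ⟦ η ⟧ (fromℕ b) x) →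
    ∃[ T ] HomogeneousInTail {2 ℕ.+ p} (2 ℕ.* p) T × (∀ b R → IsR b R →
      M̄ Q b R ≈ ((R ^ᶻ (+ 1 ℤ.- + b)) /ₛ (∂ R ^ₛ (2 ℕ.* p ℕ.+ 1))) *ₛ evalAtDerivatives {2 ℕ.+ p} T b R)
  momentPolynomial {p} Q (η , Q≡) = poly (ρ .diffPoly) , homogeneous (ρ .diffPoly) , λ b R isR → coeffs (moment-formula Q ρ
    (λ b k → trans (Q≡ b (fromℤ (ℤ.- (+ b) ℤ.+ k))) (cong (_* ⟦ η ⟧ (fromℕ b) (fromℤ (ℤ.- (+ b) ℤ.+ k))) (b+[-b+k]≡k b k))) b R isR)
    where
    ρ : Representable p (λ b k → ⟦ η ⟧ (fromℕ b) (fromℤ (ℤ.- (+ b) ℤ.+ k)))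
    ρ = representable-⟦⟧ η

open import Data.Nat.Base using (_+_; _*_)

lemma9 : ∀ (p : ℕ) (Q : Polynomial 2) → IsQ p Q →
    ∃[ T ] HomogeneousInTail {2 + p} (2 * p) T ×
    (∀ (b : ℕ) (R : PS) → IsR b R →
    M̄ Q b R ≈
    ((R ^ᶻ (+ 1 ℤ.- + b)) /ₛ (∂ R ^ₛ (2 * p + 1)))
    *ₛ evalAtDerivatives {2 + p} T b R)
lemma9 p Q isQ = momentPolynomial Q (Q-factorisation p Q isQ)
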